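{- For every integer $n\geq 2$, the degree-Kirchhoff index of the pentagonal cylinder chain $P_n$ and of the pentagonal Möbius chain $P'_n$ are \[ \operatorname{Kf}^*(P_n)=14n\left(\frac{49n^2+42n-19}{42}+ \frac{\frac{7\sqrt{6}n}{8}\left[\left(\sqrt{3}+\sqrt{2}\right)^{2n}-\left(\sqrt{3}-\sqrt{2}\right)^{2n}\right]}{(\sqrt{3}+\sqrt{2})^{2n}+(\sqrt{3}-\sqrt{2})^{2n}-2}\right), \] \[ \operatorname{Kf}^*(P'_n)=14n\left(\frac{49n^2+42n-19}{42}+ \frac{\frac{7\sqrt{6}n}{8}\left[\left(\sqrt{3}+\sqrt{2}\right)^{2n}-\left(\sqrt{3}-\sqrt{2}\right)^{2n}\right]}{(\sqrt{3}+\sqrt{2})^{2n}+(\sqrt{3}-\sqrt{2})^{2n}+2}\right). \]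
   Context: For $n\geq 2$, both graphs have vertex set $\{u_1,\dots,u_{2n}\}\cup\{u'_1,\dots,u'_{2n}\}\cup\{w_1,\dots,w_n\}$ ($5n$ vertices). Common edges: $u_ku_{k+1}$ and $u'_ku'_{k+1}$ for $1\le k\le 2n-1$; $u_{2k-1}u'_{2k-1}$ for $1\le k\le n$; $u_{2k}w_k$ and $w_ku'_{2k}$ for $1\le k\le n$. The pentagonal cylinder chain $P_n$ additionally has edges $u_{2n}u_1$ and $u'_{2n}u'_1$; the pentagonal Möbius chain $P'_n$ instead additionally has edges $u_{2n}u'_1$ and $u'_{2n}u_1$. Both have $7n$ edges; $w_k$ have degree 2, all other vertices degree 3. For a connected simple graph $G=(V,E)$ with vertex degrees $d_i$, the normalized Laplacian $\mathcal{L}(G)$ has entries $1$ on the diagonal, $-1/\sqrt{d_id_j}$ if $v_i\sim v_j$, and $0$ otherwise; if its eigenvalues are $0=\lambda_1<\lambda_2\le\cdots\le\lambda_{|V|}$, the degree-Kirchhoff index is $\operatorname{Kf}^*(G)=\frac12\sum_{i,j} d_id_jr_{ij}$ ($r_{ij}$ the effective resistance between $v_i,v_j$ with unit edge resistances), which equals $2|E|\sum_{i=2}^{|V|}1/\lambda_i$. -}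

module Defs where

open import Data.Nat as ℕ using (ℕ; zero; suc)
open import Data.Nat.Base using (_≡ᵇ_)
open import Data.Integer using (+_)
open import Data.Rational as ℚ using (ℚ; 0ℚ; 1ℚ; _+_; _*_; _-_; -_; 1/_; ≢-nonZero)
open import Data.Rational.Properties using (_≟_)
open import Data.Fin as Fin using (Fin; toℕ)
open import Data.Bool using (Bool; true; false; if_then_else_; _∧_; _∨_)
open import Data.List using (List; []; _∷_; _++_; map; upTo)
open import Data.Bool.ListAction using (any)
open import Data.Product using (Σ; _×_; _,_)
open import Relation.Binary.PropositionalEquality using (_≡_)
open import Relation.Nullary using (yes; no)

-- The two graphs, vertex set Fin (5 * n), numbered 0-based as
--   u_k  (1 ≤ k ≤ 2n)  ↦  k - 1
--   u'_k (1 ≤ k ≤ 2n)  ↦  2n + k - 1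
--   w_k  (1 ≤ k ≤ n)   ↦  4n + k - 1
-- Graphs are given by their edge lists (unordered pairs of indices).

Edge : Set
Edge = ℕ × ℕ

commonEdges : ℕ → List Edge
commonEdges n =
     map (λ k → k , suc k) (upTo (2 ℕ.* n ℕ.∸ 1))                              -- u_k u_{k+1}
  ++ map (λ k → 2 ℕ.* n ℕ.+ k , 2 ℕ.* n ℕ.+ suc k) (upTo (2 ℕ.* n ℕ.∸ 1))      -- u'_k u'_{k+1}
  ++ map (λ k → 2 ℕ.* k , 2 ℕ.* n ℕ.+ 2 ℕ.* k) (upTo n)                         -- u_{2k-1} u'_{2k-1}
  ++ map (λ k → suc (2 ℕ.* k) , 4 ℕ.* n ℕ.+ k) (upTo n)                         -- u_{2k} w_k
  ++ map (λ k → 4 ℕ.* n ℕ.+ k , 2 ℕ.* n ℕ.+ suc (2 ℕ.* k)) (upTo n)             -- w_k u'_{2k}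

-- pentagonal cylinder chain P_n : extra edges u_{2n}u_1 and u'_{2n}u'_1
cylinderEdges : ℕ → List Edge
cylinderEdges n =
  (2 ℕ.* n ℕ.∸ 1 , 0) ∷ (4 ℕ.* n ℕ.∸ 1 , 2 ℕ.* n) ∷ commonEdges n

-- pentagonal Möbius chain P'_n : extra edges u_{2n}u'_1 and u'_{2n}u_1
mobiusEdges : ℕ → List Edge
mobiusEdges n =
  (2 ℕ.* n ℕ.∸ 1 , 2 ℕ.* n) ∷ (4 ℕ.* n ℕ.∸ 1 , 0) ∷ commonEdges n

adj : List Edge → ℕ → ℕ → Bool
adj E i j = any (λ { (a , b) → ((a ≡ᵇ i) ∧ (b ≡ᵇ j)) ∨ ((a ≡ᵇ j) ∧ (b ≡ᵇ i)) }) E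

sumᶠ : ∀ {N} → (Fin N → ℚ) → ℚ
sumᶠ {zero}  f = 0ℚ
sumᶠ {suc N} f = f Fin.zero + sumᶠ (λ i → f (Fin.suc i))

indicator : Bool → ℚ
indicator b = if b then 1ℚ else 0ℚ

module _ (E : List Edge) (N : ℕ) where

  deg : Fin N → ℚ
  deg i = sumᶠ {N} (λ j → indicator (adj E (toℕ i) (toℕ j)))

  lap : (Fin N → ℚ) → Fin N → ℚ
  lap x k = deg k * x k - sumᶠ {N} (λ j → if adj E (toℕ k) (toℕ j) then x j else 0ℚ)

  δ : Fin N → Fin N → Fin N → ℚ
  δ i j k = (if Fin._≟_ k i .Relation.Nullary.Dec.does then 1ℚ else 0ℚ)
          - (if Fin._≟_ k j .Relation.Nullary.Dec.does then 1ℚ else 0ℚ)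

  IsEffectiveResistance : Fin N → Fin N → ℚ → Set
  IsEffectiveResistance i j r =
    Σ (Fin N → ℚ) λ x → ((k : Fin N) → lap x k ≡ δ i j k) × (r ≡ x i - x j)

  IsResistanceMatrix : (Fin N → Fin N → ℚ) → Set
  IsResistanceMatrix r = (i j : Fin N) → IsEffectiveResistance i j (r i j)

  kfStarSum : (Fin N → Fin N → ℚ) → ℚ
  kfStarSum r = ℚ.½ * sumᶠ (λ i → sumᶠ (λ j → deg i * deg j * r i j))

  -- K is the degree-Kirchhoff index: effective resistances exist, and for
  -- every (hence the) resistance matrix, ½ Σ d_i d_j r_ij = K.
  IsDegreeKirchhoffIndex : ℚ → Set
  IsDegreeKirchhoffIndex K =
    Σ (Fin N → Fin N → ℚ) IsResistanceMatrix
    × ((r : Fin N → Fin N → ℚ) → IsResistanceMatrix r → kfStarSum r ≡ K)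

-- Total inverse on ℚ (0⁻¹ = 0 convention; only used on nonzero values)

invℚ : ℚ → ℚ
invℚ q with q ≟ 0ℚ
... | yes _ = 0ℚ
... | no q≢0 = 1/_ q {{≢-nonZero q≢0}}

-- The field ℚ(√2) : a + b√2

record Q2 : Set where
  constructor q2
  field re im : ℚ
open Q2

module Q2Ops where
  infixl 6 _+₂_
  infixl 7 _*₂_
  infix 8 -₂_
  _+₂_ : Q2 → Q2 → Q2
  q2 a b +₂ q2 c d = q2 (a + c) (b + d)
  -₂_ : Q2 → Q2
  -₂ q2 a b = q2 (- a) (- b)
  _*₂_ : Q2 → Q2 → Q2
  q2 a b *₂ q2 c d = q2 (a * c + ℚ.normalize 2 1 * (b * d)) (a * d + b * c)
  inv₂ : Q2 → Q2
  inv₂ (q2 a b) = let m = invℚ (a * a - ℚ.normalize 2 1 * (b * b)) in q2 (a * m) (- (b * m))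
  fromℚ₂ : ℚ → Q2
  fromℚ₂ a = q2 a 0ℚ
open Q2Ops

-- The field ℚ(√2,√3) = ℚ(√2)(√3) : p + q√3 with p q ∈ ℚ(√2)

record Q23 : Set where
  constructor q23
  field re₃ im₃ : Q2

infixl 6 _⊕_ _⊖_
infixl 7 _⊗_ _⊘_
infixr 8 _^^_
infix 9 ⊝_

_⊕_ : Q23 → Q23 → Q23
q23 a b ⊕ q23 c d = q23 (a +₂ c) (b +₂ d)

⊝_ : Q23 → Q23
⊝ q23 a b = q23 (-₂ a) (-₂ b)

_⊖_ : Q23 → Q23 → Q23
x ⊖ y = x ⊕ (⊝ y)

_⊗_ : Q23 → Q23 → Q23
q23 a b ⊗ q23 c d = q23 (a *₂ c +₂ fromℚ₂ (ℚ.normalize 3 1) *₂ (b *₂ d)) (a *₂ d +₂ b *₂ c)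

inv : Q23 → Q23
inv (q23 a b) =
  let m = inv₂ (a *₂ a +₂ -₂ (fromℚ₂ (ℚ.normalize 3 1) *₂ (b *₂ b))) in
  q23 (a *₂ m) (-₂ (b *₂ m))

_⊘_ : Q23 → Q23 → Q23
x ⊘ y = x ⊗ inv y

_^^_ : Q23 → ℕ → Q23
x ^^ zero = q23 (fromℚ₂ 1ℚ) (fromℚ₂ 0ℚ)
x ^^ suc k = x ⊗ (x ^^ k)

ι : ℚ → Q23
ι a = q23 (fromℚ₂ a) (fromℚ₂ 0ℚ)

ιℕ : ℕ → Q23
ιℕ k = ι (ℚ.normalize k 1)

√2 √3 √6 : Q23
√2 = q23 (q2 0ℚ 1ℚ) (fromℚ₂ 0ℚ)
√3 = q23 (fromℚ₂ 0ℚ) (fromℚ₂ 1ℚ)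
√6 = √2 ⊗ √3

kfFormula : ℕ → Q23 → Q23
kfFormula n c =
  ιℕ (14 ℕ.* n) ⊗
    ( ((ιℕ (49 ℕ.* n ℕ.* n ℕ.+ 42 ℕ.* n) ⊖ ιℕ 19) ⊘ ιℕ 42)
    ⊕ (((ιℕ 7 ⊗ √6 ⊗ ιℕ n) ⊘ ιℕ 8) ⊗ (((√3 ⊕ √2) ^^ (2 ℕ.* n)) ⊖ ((√3 ⊖ √2) ^^ (2 ℕ.* n))))
      ⊘ (((√3 ⊕ √2) ^^ (2 ℕ.* n)) ⊕ ((√3 ⊖ √2) ^^ (2 ℕ.* n)) ⊕ c) )

{-# OPTIONS --safe #-}
-- Let d be the degree vector and c = 1/14n, the reciprocal of its sum.  If
-- L g_i = δ_i - c d and ⟨d, g_i⟩ = 0 for every vertex i, then the potential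
-- g_i - g_j has unit sources at i and j, and summing the resistances against
-- d_i d_j gives Kf* = (Σ d_i) (Σ d_i g_i(i)).  Under rotation along the chain
-- and exchange of the two strands there are three kinds of sources.  For each
-- of them the part of g that is symmetric in the strands is quadratic in the
-- cell number, and the antisymmetric part solves q (k + 2) = 10 q (k + 1) - q k
-- with q n = ± q 0 (cylinder: +, Möbius: -), whence the powers of
-- 5 ± 2√6 = (√3 ± √2)².
module Submission where

open import Defs
open import Algebra using (CommutativeRing)
open import Data.Bool using (Bool; true; false; if_then_else_; _∧_; _∨_; _xor_; not; T)
open import Data.Bool.Properties using
  (∨-comm; T-∨; T-∧; T?; xor-same; xor-assoc; xor-identityʳ; not-involutive; not-distribˡ-xor)
open import Data.Empty using (⊥-elim)
open import Data.Fin as Fin using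
  (Fin; toℕ; fromℕ; fromℕ<; inject₁; _↑ˡ_; _↑ʳ_; splitAt; combine; remQuot)
open import Data.Fin.Induction using (<-weakInduction)
open import Data.Fin.Permutation using (permutation)
open import Data.Fin.Properties using
  (toℕ-injective; toℕ-fromℕ; toℕ-fromℕ<; toℕ-inject₁; toℕ-↑ˡ; toℕ-↑ʳ; toℕ-combine; toℕ-cast; toℕ<n;
   splitAt-↑ˡ; splitAt-↑ʳ; splitAt⁻¹-↑ˡ; splitAt⁻¹-↑ʳ; remQuot-combine; combine-remQuot;
   cast-is-id; cast-involutive; fromℕ≢inject₁)
open import Data.Fin.Relation.Unary.Top using
  (View; view; ‵fromℕ; ‵inj₁; ‵inject₁; view-fromℕ; view-inject₁)
import Data.Integer as ℤ
import Data.Integer.Properties as ℤₚ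
open import Data.List using (List; []; _∷_; _++_; map; upTo; foldr)
import Data.List.Membership.DecPropositional as DecMembership
open import Data.List.Membership.Propositional using (_∈_; find; lose)
open import Data.List.Membership.Propositional.Properties using
  (∈-map⁺; ∈-map⁻; ∈-++⁺ˡ; ∈-++⁺ʳ; ∈-++⁻; ∈-upTo⁺; ∈-upTo⁻)
open import Data.List.Properties using (foldr-map)
open import Data.List.Relation.Unary.All using ([]; _∷_)
open import Data.List.Relation.Unary.All.Properties using (All¬⇒¬Any)
open import Data.List.Relation.Unary.AllPairs using ([]; _∷_)
open import Data.List.Relation.Unary.Any using (here; there)
open import Data.List.Relation.Unary.Any.Properties using (any⁺; any⁻)
open import Data.List.Relation.Unary.Unique.Propositional using (Unique)
import Data.List.Relation.Unary.Unique.Propositional.Properties as Unique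
open import Data.Nat as ℕ using (ℕ; zero; suc; s≤s; z≤n)
open import Data.Nat.Base using (_≡ᵇ_)
open import Data.Nat.Coprimality using (1-coprimeTo) renaming (sym to coprime-sym)
import Data.Nat.Properties as ℕₚ
open import Data.Nat.Solver using () renaming (module +-*-Solver to ℕ-Solver)
open import Data.Product using (Σ; _×_; _,_; proj₁; proj₂; ∃₂)
open import Data.Rational as ℚ using (ℚ; 0ℚ; 1ℚ; ½; _+_; _*_; _-_; -_)
open import Data.Rational.Properties using
  (_≟_; _≤?_; ≤-refl; ≤-trans; +-mono-≤; *-monoˡ-≤-nonNeg; +-0-commutativeMonoid; +-*-commutativeRing;
   +-identityˡ; +-identityʳ; +-assoc; *-zeroˡ; *-zeroʳ; *-identityˡ; *-identityʳ; *-comm; *-assoc;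
   *-inverseʳ; normalize-coprime)
open import Data.Rational.Solver using (module +-*-Solver)
open import Data.Sum using (_⊎_; inj₁; inj₂)
open import Data.Sum.Base using ([_,_]′)
open import Function using (_∘_; Equivalence; mk⇔; _⇔_)
open import Relation.Binary.PropositionalEquality hiding ([_])
open import Relation.Nullary using (Dec; does; yes; no; ¬_)
open import Relation.Nullary.Decidable using (does-⇔; from-no; from-yes)
import Algebra.Properties.CommutativeMonoid.Sum +-0-commutativeMonoid as ∑
import Algebra.Properties.Semiring.Sum (CommutativeRing.semiring +-*-commutativeRing) as ∑*
open +-*-Solver using (Polynomial; solve; _:=_; _:+_; _:*_; _:-_; :-_; con)
open ≡-Reasoning

-- Normalising the potentials against the degrees makes the cross terms of the double sum vanish, so
-- an automorphism has to carry along only the value of a potential at its own source. The graphs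
-- are given as numbered edge lists with a Boolean adjacency test, where neither strands nor
-- symmetries are visible. The numbers are therefore traded for vertices made of a strand and a
-- cell, with explicit neighbour lists; a single twist bit `μ` at one seam then covers both chains.
-- Each base source lies at the seam, so that source and twist enter the same equations and all
-- other cells obey one uniform recursion. Eliminating one of the two unknowns per cell leaves the
-- constant second difference 14c in the symmetric part and the factor 10 = 3 · 4 - 2 in the
-- antisymmetric part. The potentials stay rational: powers of 5 + 2√6 are kept as pairs of Pell
-- numbers, and the reciprocal `D` is used only through its defining equation. Surds appear only
-- when the closed formula is evaluated.

-- Finite sums of rationals.

sumᶠ-cong : ∀ {N} {f g : Fin N → ℚ} → (∀ i → f i ≡ g i) → sumᶠ f ≡ sumᶠ g
sumᶠ-cong {zero}  h = refl
sumᶠ-cong {suc N} h = cong₂ _+_ (h Fin.zero) (sumᶠ-cong (λ i → h (Fin.suc i)))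

sumᶠ≡sum : ∀ N (f : Fin N → ℚ) → sumᶠ f ≡ ∑.sum f
sumᶠ≡sum zero    f = refl
sumᶠ≡sum (suc N) f = cong (f Fin.zero +_) (sumᶠ≡sum N (λ i → f (Fin.suc i)))

sumᶠ-+ : ∀ N (f g : Fin N → ℚ) → sumᶠ (λ i → f i + g i) ≡ sumᶠ f + sumᶠ g
sumᶠ-+ N f g = trans (sumᶠ≡sum N _) (trans (∑.∑-distrib-+ f g) (sym (cong₂ _+_ (sumᶠ≡sum N f) (sumᶠ≡sum N g))))

sumᶠ-*ˡ : ∀ N (c : ℚ) (f : Fin N → ℚ) → sumᶠ (λ i → c * f i) ≡ c * sumᶠ f
sumᶠ-*ˡ N c f = trans (sumᶠ≡sum N _) (trans (sym (∑*.*-distribˡ-sum c f)) (cong (c *_) (sym (sumᶠ≡sum N f))))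

sumᶠ-*ʳ : ∀ N (f : Fin N → ℚ) (c : ℚ) → sumᶠ (λ i → f i * c) ≡ sumᶠ f * c
sumᶠ-*ʳ N f c = trans (sumᶠ-cong λ i → *-comm (f i) c) (trans (sumᶠ-*ˡ N c f) (*-comm c _))

sumᶠ-- : ∀ N (f g : Fin N → ℚ) → sumᶠ (λ i → f i - g i) ≡ sumᶠ f - sumᶠ g
sumᶠ-- N f g = begin
  sumᶠ (λ i → f i - g i)             ≡⟨ sumᶠ-cong (λ i → neg (f i) (g i)) ⟩
  sumᶠ (λ i → f i + (- 1ℚ) * g i)    ≡⟨ sumᶠ-+ N f _ ⟩
  sumᶠ f + sumᶠ (λ i → (- 1ℚ) * g i) ≡⟨ cong (sumᶠ f +_) (sumᶠ-*ˡ N (- 1ℚ) g) ⟩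
  sumᶠ f + (- 1ℚ) * sumᶠ g           ≡⟨ neg (sumᶠ f) (sumᶠ g) ⟨
  sumᶠ f - sumᶠ g                    ∎
  where
  neg : ∀ x y → x - y ≡ x + (- 1ℚ) * y
  neg = solve 2 (λ x y → x :- y := x :+ con (- 1ℚ) :* y) refl

sumᶠ-swap : ∀ M N (f : Fin M → Fin N → ℚ) →
  sumᶠ (λ i → sumᶠ (f i)) ≡ sumᶠ (λ j → sumᶠ (λ i → f i j))
sumᶠ-swap M N f = begin
  sumᶠ (λ i → sumᶠ (f i))             ≡⟨ double M N f ⟩
  ∑.sum (λ i → ∑.sum (f i))           ≡⟨ ∑.∑-comm f ⟩
  ∑.sum (λ j → ∑.sum (λ i → f i j))   ≡⟨ double N M (λ j i → f i j) ⟨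
  sumᶠ (λ j → sumᶠ (λ i → f i j))     ∎
  where
  double : ∀ M N (f : Fin M → Fin N → ℚ) → sumᶠ (λ i → sumᶠ (f i)) ≡ ∑.sum (λ i → ∑.sum (f i))
  double M N f = trans (sumᶠ-cong λ i → sumᶠ≡sum N (f i)) (sumᶠ≡sum M _)

sumᶠ-0 : ∀ N {f : Fin N → ℚ} → (∀ i → f i ≡ 0ℚ) → sumᶠ f ≡ 0ℚ
sumᶠ-0 zero    h = refl
sumᶠ-0 (suc N) h = trans (cong₂ _+_ (h Fin.zero) (sumᶠ-0 N λ i → h (Fin.suc i))) (+-identityʳ 0ℚ)

[_] : ∀ {p} {P : Set p} → Dec P → ℚ
[ d ] = if does d then 1ℚ else 0ℚ

sumᶠ-unit : ∀ N (i : Fin N) (f : Fin N → ℚ) → sumᶠ (λ k → [ k Fin.≟ i ] * f k) ≡ f i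
sumᶠ-unit (suc N) Fin.zero f = begin
  1ℚ * f Fin.zero + sumᶠ (λ k → 0ℚ * f (Fin.suc k))
    ≡⟨ cong₂ _+_ (*-identityˡ (f Fin.zero)) (sumᶠ-0 N λ k → *-zeroˡ (f (Fin.suc k))) ⟩
  f Fin.zero + 0ℚ ≡⟨ +-identityʳ _ ⟩
  f Fin.zero ∎
sumᶠ-unit (suc N) (Fin.suc i) f =
  trans (cong₂ _+_ (*-zeroˡ (f Fin.zero)) (sumᶠ-unit N i (λ k → f (Fin.suc k)))) (+-identityˡ _)

if-indicator : ∀ b x → (if b then x else 0ℚ) ≡ indicator b * x
if-indicator true  x = sym (*-identityˡ x)
if-indicator false x = sym (*-zeroˡ x)

-- Laplacian, effective resistance and Green functions of an arbitrary graph.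

adj-sym : ∀ E i j → adj E i j ≡ adj E j i
adj-sym []            i j = refl
adj-sym ((a , b) ∷ E) i j = cong₂ _∨_ (∨-comm ((a ≡ᵇ i) ∧ (b ≡ᵇ j)) _) (adj-sym E i j)

module _ (E : List Edge) (N : ℕ) where

  private
    d : Fin N → ℚ
    d = deg E N
    A : Fin N → Fin N → ℚ
    A i j = indicator (adj E (toℕ i) (toℕ j))

  lap-matrix : ∀ x k → lap E N x k ≡ d k * x k - sumᶠ (λ j → A k j * x j)
  lap-matrix x k = cong (_-_ (d k * x k)) (sumᶠ-cong λ j → if-indicator (adj E (toℕ k) (toℕ j)) (x j))

  lap-- : ∀ x y k → lap E N (λ i → x i - y i) k ≡ lap E N x k - lap E N y k
  lap-- x y k = begin
    lap E N (λ i → x i - y i) k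
      ≡⟨ lap-matrix _ k ⟩
    d k * (x k - y k) - sumᶠ (λ j → A k j * (x j - y j))
      ≡⟨ cong (_-_ (d k * (x k - y k))) (trans (sumᶠ-cong λ j → distr (A k j) (x j) (y j)) (sumᶠ-- N _ _)) ⟩
    d k * (x k - y k) - (sumᶠ (λ j → A k j * x j) - sumᶠ (λ j → A k j * y j))
      ≡⟨ regroup (d k) (x k) (y k) _ _ ⟩
    (d k * x k - sumᶠ (λ j → A k j * x j)) - (d k * y k - sumᶠ (λ j → A k j * y j))
      ≡⟨ cong₂ _-_ (lap-matrix x k) (lap-matrix y k) ⟨
    lap E N x k - lap E N y k ∎
    where
    distr : ∀ a b c → a * (b - c) ≡ a * b - a * c
    distr = solve 3 (λ a b c → a :* (b :- c) := a :* b :- a :* c) refl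
    regroup : ∀ d x y s t → d * (x - y) - (s - t) ≡ (d * x - s) - (d * y - t)
    regroup = solve 5 (λ d x y s t → d :* (x :- y) :- (s :- t) := (d :* x :- s) :- (d :* y :- t)) refl

  form : (Fin N → ℚ) → (Fin N → ℚ) → ℚ
  form x y = sumᶠ (λ k → lap E N x k * y k)

  form-expand : ∀ x y →
    form x y ≡ sumᶠ (λ k → d k * (x k * y k)) - sumᶠ (λ k → sumᶠ (λ j → A k j * (x j * y k)))
  form-expand x y = trans (sumᶠ-cong step) (sumᶠ-- N _ _)
    where
    step : ∀ k → lap E N x k * y k ≡ d k * (x k * y k) - sumᶠ (λ j → A k j * (x j * y k))
    step k = begin
      lap E N x k * y k
        ≡⟨ cong (_* y k) (lap-matrix x k) ⟩
      (d k * x k - sumᶠ (λ j → A k j * x j)) * y k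
        ≡⟨ solve 4 (λ d x s y → (d :* x :- s) :* y := d :* (x :* y) :- s :* y) refl (d k) (x k) _ (y k) ⟩
      d k * (x k * y k) - sumᶠ (λ j → A k j * x j) * y k
        ≡⟨ cong (_-_ (d k * (x k * y k))) (sumᶠ-*ʳ N (λ j → A k j * x j) (y k)) ⟨
      d k * (x k * y k) - sumᶠ (λ j → A k j * x j * y k)
        ≡⟨ cong (_-_ (d k * (x k * y k))) (sumᶠ-cong λ j → *-assoc (A k j) (x j) (y k)) ⟩
      d k * (x k * y k) - sumᶠ (λ j → A k j * (x j * y k)) ∎

  -- In the expanded form the degree term is visibly symmetric, and exchanging the two summations
  -- transposes the adjacency matrix, which is symmetric because `adj` reads every edge in both
  -- directions.
  form-sym : ∀ x y → form x y ≡ form y x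
  form-sym x y = begin
    form x y
      ≡⟨ form-expand x y ⟩
    sumᶠ (λ k → d k * (x k * y k)) - sumᶠ (λ k → sumᶠ (λ j → A k j * (x j * y k)))
      ≡⟨ cong₂ _-_ (sumᶠ-cong λ k → cong (d k *_) (*-comm (x k) (y k)))
           (trans (sumᶠ-swap N N _) (sumᶠ-cong λ j → sumᶠ-cong λ k →
             cong₂ _*_ (cong indicator (adj-sym E (toℕ k) (toℕ j))) (*-comm (x j) (y k)))) ⟩
    sumᶠ (λ k → d k * (y k * x k)) - sumᶠ (λ j → sumᶠ (λ k → A j k * (y k * x j)))
      ≡⟨ form-expand y x ⟨
    form y x ∎

  form-δ : ∀ x y i j → (∀ k → lap E N x k ≡ δ E N i j k) → form x y ≡ y i - y j
  form-δ x y i j h = begin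
    form x y
      ≡⟨ sumᶠ-cong (λ k → trans (cong (_* y k) (h k)) (distr [ k Fin.≟ i ] [ k Fin.≟ j ] (y k))) ⟩
    sumᶠ (λ k → [ k Fin.≟ i ] * y k - [ k Fin.≟ j ] * y k)
      ≡⟨ sumᶠ-- N _ _ ⟩
    sumᶠ (λ k → [ k Fin.≟ i ] * y k) - sumᶠ (λ k → [ k Fin.≟ j ] * y k)
      ≡⟨ cong₂ _-_ (sumᶠ-unit N i y) (sumᶠ-unit N j y) ⟩
    y i - y j ∎
    where
    distr : ∀ a b c → (a - b) * c ≡ a * c - b * c
    distr = solve 3 (λ a b c → (a :- b) :* c := a :* c :- b :* c) refl

  -- Selfadjointness of the Laplacian evaluates ⟨lap x, y⟩ in two ways.
  effectiveResistance-unique : ∀ {i j r s} →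
    IsEffectiveResistance E N i j r → IsEffectiveResistance E N i j s → r ≡ s
  effectiveResistance-unique {i} {j} (x , lx , refl) (y , ly , refl) =
    trans (sym (form-δ y x i j ly)) (trans (form-sym y x) (form-δ x y i j lx))

  -- The unit source at i lies outside the range of lap, which is orthogonal to
  -- the constants; subtracting c d repairs this and cancels in differences.
  record Green (c : ℚ) (i : Fin N) : Set where
    field
      pot      : Fin N → ℚ
      lap-pot  : ∀ k → lap E N pot k ≡ [ k Fin.≟ i ] - d k * c
      centered : sumᶠ (λ k → d k * pot k) ≡ 0ℚ

  open Green

  module _ {c : ℚ} (g : ∀ i → Green c i) where

    private
      h : Fin N → ℚ
      h i = pot (g i) i
      vol H : ℚ
      vol = sumᶠ d
      H = sumᶠ (λ i → d i * h i)

    resistance : Fin N → Fin N → ℚ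
    resistance i j = (pot (g i) i - pot (g j) i) - (pot (g i) j - pot (g j) j)

    resistance-isResistanceMatrix : IsResistanceMatrix E N resistance
    resistance-isResistanceMatrix i j = (λ k → pot (g i) k - pot (g j) k) , lap-diff , refl
      where
      lap-diff : ∀ k → lap E N (λ k → pot (g i) k - pot (g j) k) k ≡ δ E N i j k
      lap-diff k = begin
        lap E N (λ k → pot (g i) k - pot (g j) k) k
          ≡⟨ lap-- (pot (g i)) (pot (g j)) k ⟩
        lap E N (pot (g i)) k - lap E N (pot (g j)) k
          ≡⟨ cong₂ _-_ (lap-pot (g i) k) (lap-pot (g j) k) ⟩
        ([ k Fin.≟ i ] - d k * c) - ([ k Fin.≟ j ] - d k * c)
          ≡⟨ solve 3 (λ x y z → (x :- z) :- (y :- z) := x :- y) refl [ k Fin.≟ i ] [ k Fin.≟ j ] (d k * c) ⟩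
        [ k Fin.≟ i ] - [ k Fin.≟ j ] ∎

    -- Of the four potentials in `resistance i j`, the term `pot (g i) j` is summed over its own
    -- argument against the degrees and dies by `centered`; `pot (g j) i` has to wait for the outer
    -- sum over `i`.
    row-sum : ∀ i → sumᶠ (λ j → d i * d j * resistance i j)
                  ≡ d i * h i * vol - sumᶠ (λ j → d j * (d i * pot (g j) i)) + d i * H
    row-sum i = begin
      sumᶠ (λ j → d i * d j * resistance i j)
        ≡⟨ sumᶠ-cong (λ j → expand (d i) (d j) (h i) (pot (g j) i) (pot (g i) j) (h j)) ⟩
      sumᶠ (λ j → ((d i * h i * d j - d j * (d i * pot (g j) i)) - d i * (d j * pot (g i) j)) + d i * (d j * h j))
        ≡⟨ sumᶠ-+ N _ _ ⟩
      sumᶠ (λ j → (d i * h i * d j - d j * (d i * pot (g j) i)) - d i * (d j * pot (g i) j)) + sumᶠ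
        (λ j → d i * (d j * h j))
        ≡⟨ cong₂ _+_ (trans (sumᶠ-- N _ _)
             (cong₂ _-_ (trans (sumᶠ-- N _ _) (cong (_- Q) (sumᶠ-*ˡ N (d i * h i) d))) (sumᶠ-*ˡ N (d i) _)))
               (sumᶠ-*ˡ N (d i) _) ⟩
      ((d i * h i * vol - Q) - d i * sumᶠ (λ j → d j * pot (g i) j)) + d i * H
        ≡⟨ cong (λ z → ((d i * h i * vol - Q) - d i * z) + d i * H) (centered (g i)) ⟩
      ((d i * h i * vol - Q) - d i * 0ℚ) + d i * H
        ≡⟨ solve 3 (λ x y z → (x :- y :* con 0ℚ) :+ z := x :+ z) refl (d i * h i * vol - Q) (d i) (d i * H) ⟩
      (d i * h i * vol - Q) + d i * H ∎
      where
      Q = sumᶠ (λ j → d j * (d i * pot (g j) i))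
      expand : ∀ a b x y z w → a * b * ((x - y) - (z - w)) ≡ ((a * x * b - b * (a * y)) - a * (b * z)) + a * (b * w)
      expand = solve 6 (λ a b x y z w → a :* b :* ((x :- y) :- (z :- w))
        := ((a :* x :* b :- b :* (a :* y)) :- a :* (b :* z)) :+ a :* (b :* w)) refl

    kfStarSum-resistance : kfStarSum E N resistance ≡ vol * H
    kfStarSum-resistance = begin
      ½ * sumᶠ (λ i → sumᶠ (λ j → d i * d j * resistance i j))
        ≡⟨ cong (½ *_) (trans (sumᶠ-cong row-sum)
             (trans (sumᶠ-+ N _ _) (cong (_+ sumᶠ (λ i → d i * H)) (sumᶠ-- N _ _)))) ⟩
      ½ * ((sumᶠ (λ i → d i * h i * vol) - sumᶠ (λ i → sumᶠ (λ j → d j * (d i * pot (g j) i)))) + sumᶠ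
        (λ i → d i * H))
        ≡⟨ cong (½ *_) (cong₂ _+_ (cong₂ _-_ (sumᶠ-*ʳ N _ vol) mixed) (sumᶠ-*ʳ N d H)) ⟩
      ½ * ((H * vol - 0ℚ) + vol * H)
        ≡⟨ solve 2 (λ t h → con ½ :* ((h :* t :- con 0ℚ) :+ t :* h) := t :* h) refl vol H ⟩
      vol * H ∎
      where
      -- After the swap the inner sum runs over the argument of `pot (g j)`, so `centered` applies
      -- to it.
      mixed : sumᶠ (λ i → sumᶠ (λ j → d j * (d i * pot (g j) i))) ≡ 0ℚ
      mixed = trans (sumᶠ-swap N N _) (sumᶠ-0 N λ j →
        trans (sumᶠ-*ˡ N (d j) _) (trans (cong (d j *_) (centered (g j))) (*-zeroʳ (d j))))

    degreeKirchhoffIndex : IsDegreeKirchhoffIndex E N (vol * H)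
    degreeKirchhoffIndex = (resistance , resistance-isResistanceMatrix) , λ r isR →
      trans (cong (½ *_) (sumᶠ-cong λ i → sumᶠ-cong λ j →
        cong (d i * d j *_) (effectiveResistance-unique {i} {j} (isR i j) (resistance-isResistanceMatrix i j))))
        kfStarSum-resistance

-- Vertices by strand and cell, and their numbering.

Pos : ℕ → Set
Pos n = Bool × Fin n

-- a (s , k) is u_{2k+1} or u'_{2k+1} and b (s , k) is u_{2k+2} or u'_{2k+2}
-- (s = true for the primed copy), with k counted from 0.
data V (n : ℕ) : Set where
  a b : Pos n → V n
  w   : Fin n → V n

offset : ℕ → Bool → ℕ
offset n false = 0
offset n true  = 2 ℕ.* n

code : ∀ {n} → V n → ℕ
code {n} (a (s , k)) = offset n s ℕ.+ 2 ℕ.* toℕ k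
code {n} (b (s , k)) = offset n s ℕ.+ suc (2 ℕ.* toℕ k)
code {n} (w k)       = 4 ℕ.* n ℕ.+ toℕ k

-- The shape follows `combine`: `combine k t` has value 2k + t in `Fin (n * 2)`, so the vertices `a`
-- and `b` of a strand alternate as the numbering demands, and only a cast separates this type from
-- `Fin (5 * n)`.
Layered : ℕ → Set
Layered n = Fin (n ℕ.* 2 ℕ.+ (n ℕ.* 2 ℕ.+ n))

layer : ∀ n → Bool → Fin (n ℕ.* 2) → Layered n
layer n false i = i ↑ˡ (n ℕ.* 2 ℕ.+ n)
layer n true  i = (n ℕ.* 2) ↑ʳ (i ↑ˡ n)

layered : ∀ {n} → V n → Layered n
layered {n} (a (s , k)) = layer n s (combine k Fin.zero)
layered {n} (b (s , k)) = layer n s (combine k (Fin.suc Fin.zero))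
layered {n} (w k)   = (n ℕ.* 2) ↑ʳ ((n ℕ.* 2) ↑ʳ k)

rung : ∀ {n} → Bool → Fin n × Fin 2 → V n
rung s (k , Fin.zero)         = a (s , k)
rung s (k , Fin.suc Fin.zero) = b (s , k)

unlayered : ∀ {n} → Layered n → V n
unlayered {n} i =
  [ rung false ∘ remQuot 2 , [ rung true ∘ remQuot 2 , w ]′ ∘ splitAt (n ℕ.* 2) ]′ (splitAt (n ℕ.* 2) i)

unlayered-layer : ∀ {n} s (i : Fin (n ℕ.* 2)) → unlayered {n} (layer n s i) ≡ rung s (remQuot 2 i)
unlayered-layer {n} false i rewrite splitAt-↑ˡ (n ℕ.* 2) i (n ℕ.* 2 ℕ.+ n) = refl
unlayered-layer {n} true  i
  rewrite splitAt-↑ʳ (n ℕ.* 2) (n ℕ.* 2 ℕ.+ n) (i ↑ˡ n) | splitAt-↑ˡ (n ℕ.* 2) i n = refl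

unlayered-layered : ∀ {n} (v : V n) → unlayered (layered v) ≡ v
unlayered-layered {n} (a (s , k)) = trans (unlayered-layer s _) (cong (rung s) (remQuot-combine k Fin.zero))
unlayered-layered {n} (b (s , k)) = trans (unlayered-layer s _) (cong (rung s) (remQuot-combine k (Fin.suc Fin.zero)))
unlayered-layered {n} (w k)
  rewrite splitAt-↑ʳ (n ℕ.* 2) (n ℕ.* 2 ℕ.+ n) ((n ℕ.* 2) ↑ʳ k) | splitAt-↑ʳ (n ℕ.* 2) n k = refl

layered-rung : ∀ {n} s (p : Fin n × Fin 2) → layered (rung s p) ≡ layer n s (combine (proj₁ p) (proj₂ p))
layered-rung {n} s (k , Fin.zero)         = refl
layered-rung {n} s (k , Fin.suc Fin.zero) = refl

layered-unlayered : ∀ {n} (i : Layered n) → layered (unlayered {n} i) ≡ i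
layered-unlayered {n} i with splitAt (n ℕ.* 2) i in eq
... | inj₁ j = trans (layered-rung false (remQuot {n} 2 j))
  (trans (cong (layer n false) (combine-remQuot {n} 2 j)) (splitAt⁻¹-↑ˡ eq))
... | inj₂ j with splitAt (n ℕ.* 2) j in eq′
...   | inj₁ l = trans (layered-rung true (remQuot {n} 2 l))
  (trans (cong (layer n true) (combine-remQuot {n} 2 l))
    (trans (cong ((n ℕ.* 2) ↑ʳ_) (splitAt⁻¹-↑ˡ eq′)) (splitAt⁻¹-↑ʳ {n ℕ.* 2} eq)))
...   | inj₂ l = trans (cong ((n ℕ.* 2) ↑ʳ_) (splitAt⁻¹-↑ʳ {n ℕ.* 2} eq′)) (splitAt⁻¹-↑ʳ {n ℕ.* 2} eq)

size : ∀ n → n ℕ.* 2 ℕ.+ (n ℕ.* 2 ℕ.+ n) ≡ 5 ℕ.* n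
size = ℕ-Solver.solve 1 (λ n → n ℕ-Solver.:* ℕ-Solver.con 2 ℕ-Solver.:+ (n ℕ-Solver.:* ℕ-Solver.con 2 ℕ-Solver.:+ n)
  ℕ-Solver.:= ℕ-Solver.con 5 ℕ-Solver.:* n) refl

enc : ∀ {n} → V n → Fin (5 ℕ.* n)
enc {n} v = Fin.cast (size n) (layered v)

dec : ∀ {n} → Fin (5 ℕ.* n) → V n
dec {n} i = unlayered (Fin.cast (sym (size n)) i)

dec-enc : ∀ {n} (v : V n) → dec (enc v) ≡ v
dec-enc {n} v = trans (cong unlayered (cast-involutive (sym (size n)) (size n) (layered v))) (unlayered-layered v)

enc-dec : ∀ {n} (i : Fin (5 ℕ.* n)) → enc (dec {n} i) ≡ i
enc-dec {n} i = trans (cong (Fin.cast (size n)) (layered-unlayered {n} _)) (cast-involutive (size n) (sym (size n)) i)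

enc-injective : ∀ {n} {u v : V n} → enc u ≡ enc v → u ≡ v
enc-injective eq = trans (sym (dec-enc _)) (trans (cong dec eq) (dec-enc _))

toℕ-layer : ∀ {n} s (k : Fin n) t → toℕ (layer n s (combine k t)) ≡ offset n s ℕ.+ (2 ℕ.* toℕ k ℕ.+ toℕ t)
toℕ-layer {n} false k t = trans (toℕ-↑ˡ (combine k t) _) (toℕ-combine k t)
toℕ-layer {n} true  k t = trans (toℕ-↑ʳ (n ℕ.* 2) (combine k t ↑ˡ n))
  (cong₂ ℕ._+_ (ℕₚ.*-comm n 2) (trans (toℕ-↑ˡ (combine k t) n) (toℕ-combine k t)))

toℕ-layered : ∀ {n} (v : V n) → toℕ (layered v) ≡ code v
toℕ-layered {n} (a (s , k)) = trans (toℕ-layer s k Fin.zero) (cong (offset n s ℕ.+_) (ℕₚ.+-identityʳ _))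
toℕ-layered {n} (b (s , k)) = trans (toℕ-layer s k (Fin.suc Fin.zero)) (cong (offset n s ℕ.+_) (ℕₚ.+-comm _ 1))
toℕ-layered {n} (w k) = trans (toℕ-↑ʳ (n ℕ.* 2) _) (trans (cong (n ℕ.* 2 ℕ.+_) (toℕ-↑ʳ (n ℕ.* 2) k))
  (ℕ-Solver.solve 2 (λ n k → n ℕ-Solver.:* ℕ-Solver.con 2 ℕ-Solver.:+ (n ℕ-Solver.:* ℕ-Solver.con 2 ℕ-Solver.:+ k)
     ℕ-Solver.:= ℕ-Solver.con 4 ℕ-Solver.:* n ℕ-Solver.:+ k) refl n (toℕ k)))

toℕ-enc : ∀ {n} (v : V n) → toℕ (enc v) ≡ code v
toℕ-enc {n} v = trans (toℕ-cast (size n) (layered v)) (toℕ-layered v)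

-- `code` is `toℕ` of `enc`, which has the left inverse `dec`; this replaces a comparison of
-- numerical ranges and parities.
code-injective : ∀ {n} {u v : V n} → code u ≡ code v → u ≡ v
code-injective {u = u} {v} eq = enc-injective (toℕ-injective (trans (toℕ-enc u) (trans eq (sym (toℕ-enc v)))))

sumᶠ-++ : ∀ m n (f : Fin (m ℕ.+ n) → ℚ) → sumᶠ f ≡ sumᶠ (λ i → f (i ↑ˡ n)) + sumᶠ (λ j → f (m ↑ʳ j))
sumᶠ-++ zero    n f = sym (+-identityˡ _)
sumᶠ-++ (suc m) n f = trans (cong (f Fin.zero +_) (sumᶠ-++ m n (λ i → f (Fin.suc i))))
  (sym (+-assoc (f Fin.zero) _ _))

sumᶠ-pairs : ∀ n (f : Fin (n ℕ.* 2) → ℚ) →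
  sumᶠ f ≡ sumᶠ (λ k → f (combine {n} k Fin.zero) + f (combine {n} k (Fin.suc Fin.zero)))
sumᶠ-pairs zero    f = refl
sumᶠ-pairs (suc n) f = trans (sym (+-assoc (f Fin.zero) _ _))
  (cong (f Fin.zero + f (Fin.suc Fin.zero) +_) (sumᶠ-pairs n (λ i → f (Fin.suc (Fin.suc i)))))

sumᶠ-cast : ∀ {M N} (eq : M ≡ N) (f : Fin N → ℚ) → sumᶠ f ≡ sumᶠ (λ i → f (Fin.cast eq i))
sumᶠ-cast refl f = sumᶠ-cong λ i → cong f (sym (cast-is-id refl i))

sumV : ∀ {n} → (V n → ℚ) → ℚ
sumV {n} f = sumᶠ {n} (λ k → f (a (false , k)) + f (b (false , k)))
          + (sumᶠ {n} (λ k → f (a (true , k)) + f (b (true , k))) + sumᶠ {n} (λ k → f (w k)))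

sumᶠ-enc : ∀ n (f : Fin (5 ℕ.* n) → ℚ) → sumᶠ f ≡ sumV {n} (λ v → f (enc v))
sumᶠ-enc n f = begin
  sumᶠ f
    ≡⟨ sumᶠ-cast (size n) f ⟩
  sumᶠ f′
    ≡⟨ sumᶠ-++ (n ℕ.* 2) (n ℕ.* 2 ℕ.+ n) f′ ⟩
  sumᶠ (λ i → f′ (layer n false i)) + sumᶠ (λ j → f′ ((n ℕ.* 2) ↑ʳ j))
    ≡⟨ cong₂ _+_ (sumᶠ-pairs n (λ i → f′ (layer n false i)))
         (trans (sumᶠ-++ (n ℕ.* 2) n (λ j → f′ ((n ℕ.* 2) ↑ʳ j)))
           (cong (_+ sumᶠ (λ k → f′ (layered {n} (w k)))) (sumᶠ-pairs n (λ i → f′ (layer n true i))))) ⟩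
  sumV {n} (λ v → f (enc v)) ∎
  where
  f′ : Layered n → ℚ
  f′ i = f (Fin.cast (size n) i)

-- From edge lists to neighbour lists.

half : ∀ k → Σ ℕ λ j → k ≡ 2 ℕ.* j ⊎ k ≡ suc (2 ℕ.* j)
half zero = 0 , inj₁ refl
half (suc k) with half k
... | j , inj₁ refl = j , inj₂ refl
... | j , inj₂ refl = suc j , inj₁ (sym (ℕₚ.*-suc 2 j))

∈-map-upTo : ∀ {A : Set} {f : ℕ → A} {N e} k → k ℕ.< N → e ≡ f k → e ∈ map f (upTo N)
∈-map-upTo {f = f} k k<N refl = ∈-map⁺ f (∈-upTo⁺ k<N)

∈-map-upTo⁻ : ∀ {A : Set} {f : ℕ → A} {N e} → e ∈ map f (upTo N) → Σ ℕ λ k → k ℕ.< N × e ≡ f k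
∈-map-upTo⁻ {f = f} e∈ with ∈-map⁻ f e∈
... | k , k∈ , eq = k , ∈-upTo⁻ k∈ , eq

-- Uniqueness matters because the indicator counts an entry once while the fold counts every
-- occurrence.
sumᶠ-∈ : ∀ N (l : List (Fin N)) → Unique l → (f : Fin N → ℚ) → let open DecMembership (Fin._≟_ {N}) in
  sumᶠ (λ j → if does (j ∈? l) then f j else 0ℚ) ≡ foldr (λ j acc → f j + acc) 0ℚ l
sumᶠ-∈ N [] u f = sumᶠ-0 N λ _ → refl
sumᶠ-∈ N (i ∷ l) (i∉l ∷ u) f = begin
  sumᶠ (λ j → if does (j ∈? (i ∷ l)) then f j else 0ℚ)
    ≡⟨ sumᶠ-cong step ⟩
  sumᶠ (λ j → [ j Fin.≟ i ] * f j + (if does (j ∈? l) then f j else 0ℚ))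
    ≡⟨ sumᶠ-+ N _ _ ⟩
  sumᶠ (λ j → [ j Fin.≟ i ] * f j) + sumᶠ (λ j → if does (j ∈? l) then f j else 0ℚ)
    ≡⟨ cong₂ _+_ (sumᶠ-unit N i f) (sumᶠ-∈ N l u f) ⟩
  f i + foldr (λ j acc → f j + acc) 0ℚ l ∎
  where
  open DecMembership (Fin._≟_ {N})
  step : ∀ j → (if does (j ∈? (i ∷ l)) then f j else 0ℚ) ≡ [ j Fin.≟ i ] * f j + (if does (j ∈? l) then f j else 0ℚ)
  step j with j Fin.≟ i | j ∈? l
  ... | yes refl | yes i∈l = ⊥-elim (All¬⇒¬Any i∉l i∈l)
  ... | yes refl | no _ = sym (trans (+-identityʳ _) (*-identityˡ (f j)))
  ... | no _ | d = sym (trans (cong (_+ (if does d then f j else 0ℚ)) (*-zeroˡ (f j))) (+-identityˡ _))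

edges : Bool → ℕ → List Edge
edges μ n = if μ then mobiusEdges n else cylinderEdges n

flip : ∀ {n} → Pos n → Pos n
flip (s , k) = not s , k

-- The chain has n = l + 2 cells; μ = true gives the Möbius chain.
module Chain (μ : Bool) (l : ℕ) where

  m n : ℕ
  m = suc l
  n = suc m

  last : Fin n
  last = fromℕ m

  -- The seam between the last cell and cell 0 is the only place where the chains differ: crossing
  -- it adds the twist `μ` to the strand.
  prev : Pos n → Pos n
  prev (s , Fin.zero)  = s xor μ , last
  prev (s , Fin.suc i) = s , inject₁ i

  next : Pos n → Pos n
  next (s , i) with view i
  ... | ‵fromℕ     = s xor μ , Fin.zero
  ... | ‵inject₁ i = s , Fin.suc i

  next-last : ∀ s → next (s , last) ≡ (s xor μ , Fin.zero)
  next-last s rewrite view-fromℕ m = refl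

  next-inject₁ : ∀ s i → next (s , inject₁ i) ≡ (s , Fin.suc i)
  next-inject₁ s i rewrite view-inject₁ i = refl

  xor-cancelʳ : ∀ s → (s xor μ) xor μ ≡ s
  xor-cancelʳ s = trans (xor-assoc s μ μ) (trans (cong (s xor_) (xor-same μ)) (xor-identityʳ s))

  next-prev : ∀ p → next (prev p) ≡ p
  next-prev (s , Fin.zero)  = trans (next-last (s xor μ)) (cong (_, Fin.zero) (xor-cancelʳ s))
  next-prev (s , Fin.suc i) = next-inject₁ s i

  prev-next : ∀ p → prev (next p) ≡ p
  prev-next (s , i) with view i
  ... | ‵fromℕ     = cong (_, last) (xor-cancelʳ s)
  ... | ‵inject₁ i = refl

  -- This is where two cells are required: `last` is then a successor and cannot be cell 0. On a
  -- cylinder with one cell, `prev p` would be `p` and two entries of a neighbour list would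
  -- coincide.
  prev≢ : ∀ p → p ≢ prev p
  prev≢ (s , Fin.zero)  ()
  prev≢ (s , Fin.suc i) eq = ℕₚ.1+n≢n (trans (cong (toℕ ∘ proj₂) eq) (toℕ-inject₁ i))

  next≢ : ∀ p → p ≢ next p
  next≢ p eq = prev≢ p (sym (trans (cong prev eq) (prev-next p)))

  -- Every edge occurs once, oriented as in the edge lists. Indexing `ba` by its `a`-end lets the
  -- two wrapping edges share a constructor with the interior ones, as the case of cell 0.
  data Arc : V n → V n → Set where
    ab : ∀ p → Arc (a p) (b p)
    ba : ∀ p → Arc (b (prev p)) (a p)
    aa : ∀ k → Arc (a (false , k)) (a (true , k))
    bw : ∀ k → Arc (b (false , k)) (w k)
    wb : ∀ k → Arc (w k) (b (true , k))

  pair : V n → V n → Edge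
  pair x y = code x , code y

  path : Bool → List Edge
  path s = map (λ k → offset n s ℕ.+ k , offset n s ℕ.+ suc k) (upTo (2 ℕ.* n ℕ.∸ 1))

  rungs uppers lowers : List Edge
  rungs  = map (λ k → 2 ℕ.* k , 2 ℕ.* n ℕ.+ 2 ℕ.* k) (upTo n)
  uppers = map (λ k → suc (2 ℕ.* k) , 4 ℕ.* n ℕ.+ k) (upTo n)
  lowers = map (λ k → 4 ℕ.* n ℕ.+ k , 2 ℕ.* n ℕ.+ suc (2 ℕ.* k)) (upTo n)

  2n-1 : 2 ℕ.* n ℕ.∸ 1 ≡ suc (2 ℕ.* m)
  2n-1 = cong (ℕ._∸ 1) (ℕₚ.*-suc 2 m)

  offset-last : ∀ s → offset n s ℕ.+ suc (2 ℕ.* toℕ last) ≡ offset n s ℕ.+ (2 ℕ.* n ℕ.∸ 1)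
  offset-last s = cong (offset n s ℕ.+_) (trans (cong (λ k → suc (2 ℕ.* k)) (toℕ-fromℕ m)) (sym 2n-1))

  4n-1 : 4 ℕ.* n ℕ.∸ 1 ≡ 2 ℕ.* n ℕ.+ (2 ℕ.* n ℕ.∸ 1)
  4n-1 = trans (cong (ℕ._∸ 1) (ℕₚ.*-distribʳ-+ n 2 2)) (ℕₚ.+-∸-assoc (2 ℕ.* n) {2 ℕ.* n} (s≤s z≤n))

  -- The target strand is `s xor ν` in evaluated form. The twist is a separate argument so that
  -- `edges-split` holds by computation for each of its values.
  wrapOf : Bool → Bool → List Edge
  wrapOf ν false = (2 ℕ.* n ℕ.∸ 1 , offset n ν) ∷ []
  wrapOf ν true  = (4 ℕ.* n ℕ.∸ 1 , offset n (not ν)) ∷ []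

  wrap : Bool → List Edge
  wrap = wrapOf μ

  segments : List Edge
  segments = wrap false ++ wrap true ++ path false ++ path true ++ rungs ++ uppers ++ lowers

  edges-split : edges μ n ≡ segments
  edges-split = split μ
    where
    split : ∀ ν → edges ν n ≡ wrapOf ν false ++ wrapOf ν true ++ path false ++ path true ++ rungs ++ uppers ++ lowers
    split false = refl
    split true  = refl

  wrap-pair : ∀ s → pair (b (s , last)) (a (s xor μ , Fin.zero)) ∈ wrap s
  wrap-pair false = here (cong₂ _,_ (offset-last false) (ℕₚ.+-identityʳ _))
  wrap-pair true  = here (cong₂ _,_ (trans (offset-last true) (sym 4n-1)) (ℕₚ.+-identityʳ _))

  wrap⁻ : ∀ s {e} → e ∈ wrap s → e ≡ pair (b (s , last)) (a (s xor μ , Fin.zero))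
  wrap⁻ false (here eq) = trans eq (cong₂ _,_ (sym (offset-last false)) (sym (ℕₚ.+-identityʳ _)))
  wrap⁻ true  (here eq) = trans eq (cong₂ _,_ (trans 4n-1 (sym (offset-last true))) (sym (ℕₚ.+-identityʳ _)))

  2*<2n-1 : ∀ {j} → j ℕ.< n → 2 ℕ.* j ℕ.< 2 ℕ.* n ℕ.∸ 1
  2*<2n-1 {j} (s≤s j≤m) = subst (2 ℕ.* j ℕ.<_) (sym 2n-1) (s≤s (ℕₚ.*-monoʳ-≤ 2 j≤m))

  2*<2n-1⁻ : ∀ {j} → 2 ℕ.* j ℕ.< 2 ℕ.* n ℕ.∸ 1 → j ℕ.< n
  2*<2n-1⁻ {j} lt with subst (2 ℕ.* j ℕ.<_) 2n-1 lt
  ... | s≤s le = s≤s (ℕₚ.*-cancelˡ-≤ 2 le)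

  2*+1<2n-1 : ∀ {j} → j ℕ.< m → suc (2 ℕ.* j) ℕ.< 2 ℕ.* n ℕ.∸ 1
  2*+1<2n-1 {j} j<m = subst (suc (2 ℕ.* j) ℕ.<_) (sym 2n-1) (s≤s (ℕₚ.*-monoʳ-< 2 j<m))

  2*+1<2n-1⁻ : ∀ {j} → suc (2 ℕ.* j) ℕ.< 2 ℕ.* n ℕ.∸ 1 → j ℕ.< m
  2*+1<2n-1⁻ {j} lt with subst (suc (2 ℕ.* j) ℕ.<_) 2n-1 lt
  ... | s≤s lt′ = ℕₚ.*-cancelˡ-< 2 j m lt′

  pair-ab : ∀ s (i : Fin n) → pair (a (s , i)) (b (s , i)) ∈ path s
  pair-ab s i = ∈-map-upTo (2 ℕ.* toℕ i) (2*<2n-1 (toℕ<n i)) refl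

  step-eq : ∀ s (i : Fin m) → pair (b (s , inject₁ i)) (a (s , Fin.suc i))
          ≡ (offset n s ℕ.+ suc (2 ℕ.* toℕ i) , offset n s ℕ.+ suc (suc (2 ℕ.* toℕ i)))
  step-eq s i = cong₂ _,_ (cong (λ k → offset n s ℕ.+ suc (2 ℕ.* k)) (toℕ-inject₁ i))
                          (cong (offset n s ℕ.+_) (ℕₚ.*-suc 2 (toℕ i)))

  pair-ba : ∀ s (i : Fin m) → pair (b (s , inject₁ i)) (a (s , Fin.suc i)) ∈ path s
  pair-ba s i = ∈-map-upTo (suc (2 ℕ.* toℕ i)) (2*+1<2n-1 (toℕ<n i)) (step-eq s i)

  ArcOf : Edge → Set
  ArcOf e = ∃₂ λ x y → Arc x y × e ≡ pair x y

  -- The parity of the position on the path decides: a step from an even position stays in its cell,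
  -- one from an odd position enters the next cell.
  path⁻ : ∀ s {e} → e ∈ path s → ArcOf e
  path⁻ s e∈ with ∈-map-upTo⁻ e∈
  ... | k , k< , eq with half k
  ...   | j , inj₁ refl =
    _ , _ , ab (s , i) , trans eq
      (cong (λ k → offset n s ℕ.+ 2 ℕ.* k , offset n s ℕ.+ suc (2 ℕ.* k)) (sym (toℕ-fromℕ< (2*<2n-1⁻ {j} k<))))
    where i = fromℕ< (2*<2n-1⁻ {j} k<)
  ...   | j , inj₂ refl = _ , _ , ba (s , Fin.suc i) , trans eq
    (trans (cong (λ k → offset n s ℕ.+ suc (2 ℕ.* k) , offset n s ℕ.+ suc (suc (2 ℕ.* k)))
      (sym (toℕ-fromℕ< (2*+1<2n-1⁻ {j} k<)))) (sym (step-eq s i)))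
    where i = fromℕ< (2*+1<2n-1⁻ {j} k<)

  indexed⁻ : ∀ {f : ℕ → Edge} {x y : Fin n → V n} → (∀ k → Arc (x k) (y k)) → (∀ k → f (toℕ k) ≡ pair (x k) (y k)) →
    ∀ {e} → e ∈ map f (upTo n) → ArcOf e
  indexed⁻ {f} arc f≡ e∈ with ∈-map-upTo⁻ e∈
  ... | k , k< , eq = _ , _ , arc (fromℕ< k<) , trans eq (trans (cong f (sym (toℕ-fromℕ< k<))) (f≡ (fromℕ< k<)))

  edges⇒Arc : ∀ {e} → e ∈ edges μ n → ArcOf e
  edges⇒Arc {e} e∈ = go (subst (e ∈_) edges-split e∈)
    where
    wrapArc : ∀ s → Arc (b (s , last)) (a (s xor μ , Fin.zero))
    -- The arc `ba (s xor μ , Fin.zero)` starts on strand `(s xor μ) xor μ`, where the two twists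
    -- cancel.
    wrapArc s = subst (λ t → Arc (b (t , last)) (a (s xor μ , Fin.zero))) (xor-cancelʳ s) (ba (s xor μ , Fin.zero))
    go : e ∈ segments → ArcOf e
    go e∈ with ∈-++⁻ (wrap false) e∈
    ... | inj₁ e∈ = _ , _ , wrapArc false , wrap⁻ false e∈
    ... | inj₂ e∈ with ∈-++⁻ (wrap true) e∈
    ...  | inj₁ e∈ = _ , _ , wrapArc true , wrap⁻ true e∈
    ...  | inj₂ e∈ with ∈-++⁻ (path false) e∈
    ...   | inj₁ e∈ = path⁻ false e∈
    ...   | inj₂ e∈ with ∈-++⁻ (path true) e∈
    ...    | inj₁ e∈ = path⁻ true e∈
    ...    | inj₂ e∈ with ∈-++⁻ rungs e∈
    ...     | inj₁ e∈ = indexed⁻ aa (λ _ → refl) e∈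
    ...     | inj₂ e∈ with ∈-++⁻ uppers e∈
    ...      | inj₁ e∈ = indexed⁻ bw (λ _ → refl) e∈
    ...      | inj₂ e∈ = indexed⁻ wb (λ _ → refl) e∈

  Arc⇒edges : ∀ {x y} → Arc x y → pair x y ∈ edges μ n
  Arc⇒edges {x} {y} arc = subst (pair x y ∈_) (sym edges-split) (go arc)
    where
    in-wrap : ∀ s {e} → e ∈ wrap s → e ∈ segments
    in-wrap false e∈ = ∈-++⁺ˡ e∈
    in-wrap true  e∈ = ∈-++⁺ʳ (wrap false) (∈-++⁺ˡ e∈)
    in-path : ∀ s {e} → e ∈ path s → e ∈ segments
    in-path false e∈ = there (there (∈-++⁺ˡ e∈))
    in-path true  e∈ = there (there (∈-++⁺ʳ (path false) (∈-++⁺ˡ e∈)))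
    in-rest : ∀ {e} → e ∈ rungs ++ uppers ++ lowers → e ∈ segments
    in-rest e∈ = there (there (∈-++⁺ʳ (path false) (∈-++⁺ʳ (path true) e∈)))
    go : ∀ {x y} → Arc x y → pair x y ∈ segments
    go (ab (s , i)) = in-path s (pair-ab s i)
    go (ba (s , Fin.zero)) = in-wrap (s xor μ)
      (subst (λ t → pair (b (s xor μ , last)) (a (t , Fin.zero)) ∈ wrap (s xor μ)) (xor-cancelʳ s)
        (wrap-pair (s xor μ)))
    go (ba (s , Fin.suc i)) = in-path s (pair-ba s i)
    go (aa k) = in-rest (∈-++⁺ˡ (∈-map-upTo (toℕ k) (toℕ<n k) refl))
    go (bw k) = in-rest (∈-++⁺ʳ rungs (∈-++⁺ˡ (∈-map-upTo (toℕ k) (toℕ<n k) refl)))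
    go (wb k) = in-rest (∈-++⁺ʳ rungs (∈-++⁺ʳ uppers (∈-map-upTo (toℕ k) (toℕ<n k) refl)))

  adj⇒Arc : ∀ {x y} → T (adj (edges μ n) (code x) (code y)) → Arc x y ⊎ Arc y x
  adj⇒Arc {x} {y} t with find (any⁻ _ (edges μ n) t)
  ... | (i , j) , e∈ , t′ with edges⇒Arc e∈
  ...   | x′ , y′ , arc , refl with Equivalence.to T-∨ t′
  ...     | inj₁ h = inj₁ (subst₂ Arc (code-injective (ℕₚ.≡ᵇ⇒≡ _ _ (proj₁ (Equivalence.to T-∧ h))))
                                      (code-injective (ℕₚ.≡ᵇ⇒≡ _ _ (proj₂ (Equivalence.to T-∧ h)))) arc)
  ...     | inj₂ h = inj₂ (subst₂ Arc (code-injective (ℕₚ.≡ᵇ⇒≡ _ _ (proj₁ (Equivalence.to T-∧ h))))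
                                      (code-injective (ℕₚ.≡ᵇ⇒≡ _ _ (proj₂ (Equivalence.to T-∧ h)))) arc)

  Arc⇒adj : ∀ {x y} → Arc x y → T (adj (edges μ n) (code x) (code y))
  Arc⇒adj {x} {y} arc = any⁺ _ (lose (Arc⇒edges arc)
    (Equivalence.from T-∨ (inj₁ (Equivalence.from T-∧ (ℕₚ.≡⇒≡ᵇ (code x) _ refl , ℕₚ.≡⇒≡ᵇ (code y) _ refl)))))

  nbrs : V n → List (V n)
  nbrs (a p) = b p ∷ b (prev p) ∷ a (flip p) ∷ []
  nbrs (b p) = a p ∷ a (next p) ∷ w (proj₂ p) ∷ []
  nbrs (w k) = b (false , k) ∷ b (true , k) ∷ []

  Arc⇒nbr : ∀ {x y} → Arc x y → y ∈ nbrs x × x ∈ nbrs y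
  Arc⇒nbr (ab p) = here refl , here refl
  Arc⇒nbr (ba p) = there (here (cong a (sym (next-prev p)))) , there (here refl)
  Arc⇒nbr (aa k) = there (there (here refl)) , there (there (here refl))
  Arc⇒nbr (bw k) = there (there (here refl)) , here refl
  Arc⇒nbr (wb k) = there (here refl) , there (there (here refl))

  nbr⇒Arc : ∀ x {y} → y ∈ nbrs x → Arc x y ⊎ Arc y x
  nbr⇒Arc (a p) (here refl) = inj₁ (ab p)
  nbr⇒Arc (a p) (there (here refl)) = inj₂ (ba p)
  nbr⇒Arc (a (false , k)) (there (there (here refl))) = inj₁ (aa k)
  nbr⇒Arc (a (true , k)) (there (there (here refl))) = inj₂ (aa k)
  nbr⇒Arc (b p) (here refl) = inj₂ (ab p)
  nbr⇒Arc (b p) (there (here refl)) = inj₁ (subst (λ q → Arc (b q) (a (next p))) (prev-next p) (ba (next p)))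
  nbr⇒Arc (b (false , k)) (there (there (here refl))) = inj₁ (bw k)
  nbr⇒Arc (b (true , k)) (there (there (here refl))) = inj₂ (wb k)
  nbr⇒Arc (w k) (here refl) = inj₂ (bw k)
  nbr⇒Arc (w k) (there (here refl)) = inj₁ (wb k)

  a-injective : ∀ {p q : Pos n} → a p ≡ a q → p ≡ q
  a-injective refl = refl

  b-injective : ∀ {p q : Pos n} → b p ≡ b q → p ≡ q
  b-injective refl = refl

  nbrs-unique : ∀ x → Unique (nbrs x)
  nbrs-unique (a p) = ((λ eq → prev≢ p (b-injective eq)) ∷ (λ ()) ∷ []) ∷ ((λ ()) ∷ []) ∷ [] ∷ []
  nbrs-unique (b p) = ((λ eq → next≢ p (a-injective eq)) ∷ (λ ()) ∷ []) ∷ ((λ ()) ∷ []) ∷ [] ∷ []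
  nbrs-unique (w k) = ((λ ()) ∷ []) ∷ [] ∷ []

  adj⇔nbr : ∀ x y → T (adj (edges μ n) (code x) (code y)) ⇔ y ∈ nbrs x
  adj⇔nbr x y = mk⇔ to from
    where
    to : T (adj (edges μ n) (code x) (code y)) → y ∈ nbrs x
    to t with adj⇒Arc t
    ... | inj₁ arc = proj₁ (Arc⇒nbr arc)
    ... | inj₂ arc = proj₂ (Arc⇒nbr arc)
    from : y ∈ nbrs x → T (adj (edges μ n) (code x) (code y))
    from y∈ with nbr⇒Arc x y∈
    ... | inj₁ arc = Arc⇒adj arc
    ... | inj₂ arc = subst T (adj-sym (edges μ n) (code y) (code x)) (Arc⇒adj arc)

  nbrSum : (V n → ℚ) → V n → ℚ
  nbrSum f x = foldr (λ y acc → f y + acc) 0ℚ (nbrs x)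

  -- Since `does (T? t)` is `t` itself, `does-⇔` exchanges the Boolean search through all edges for
  -- membership in a list of at most three neighbours.
  sum-adj : ∀ (f : Fin (5 ℕ.* n) → ℚ) x →
    sumᶠ (λ j → if adj (edges μ n) (toℕ (enc x)) (toℕ j) then f j else 0ℚ) ≡ nbrSum (λ y → f (enc y)) x
  sum-adj f x = begin
    sumᶠ (λ j → if adj (edges μ n) (toℕ (enc x)) (toℕ j) then f j else 0ℚ)
      ≡⟨ sumᶠ-cong (λ j → cong (λ t → if t then f j else 0ℚ)
           (does-⇔ (adj⇔∈ j) (T? (adj (edges μ n) (toℕ (enc x)) (toℕ j))) (j ∈? map enc (nbrs x)))) ⟩
    sumᶠ (λ j → if does (j ∈? map enc (nbrs x)) then f j else 0ℚ)
      ≡⟨ sumᶠ-∈ (5 ℕ.* n) (map enc (nbrs x)) (Unique.map⁺ enc-injective (nbrs-unique x)) f ⟩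
    foldr (λ j acc → f j + acc) 0ℚ (map enc (nbrs x))
      ≡⟨ foldr-map (λ j acc → f j + acc) enc 0ℚ (nbrs x) ⟩
    nbrSum (λ y → f (enc y)) x ∎
    where
    open DecMembership (Fin._≟_ {5 ℕ.* n}) using (_∈?_)
    adj⇔∈ : ∀ j → T (adj (edges μ n) (toℕ (enc x)) (toℕ j)) ⇔ j ∈ map enc (nbrs x)
    adj⇔∈ j = mk⇔ to from
      where
      codes : adj (edges μ n) (toℕ (enc x)) (toℕ j) ≡ adj (edges μ n) (code x) (code (dec {n} j))
      codes = cong₂ (adj (edges μ n)) (toℕ-enc x) (trans (cong toℕ (sym (enc-dec {n} j))) (toℕ-enc (dec {n} j)))
      to : T (adj (edges μ n) (toℕ (enc x)) (toℕ j)) → j ∈ map enc (nbrs x)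
      to t = subst (_∈ map enc (nbrs x)) (enc-dec {n} j)
        (∈-map⁺ enc (Equivalence.to (adj⇔nbr x (dec j)) (subst T codes t)))
      from : j ∈ map enc (nbrs x) → T (adj (edges μ n) (toℕ (enc x)) (toℕ j))
      from j∈ = let y , y∈ , eq = ∈-map⁻ enc j∈ in
        subst (λ j → T (adj (edges μ n) (toℕ (enc x)) (toℕ j))) (sym eq)
          (subst₂ (λ i j → T (adj (edges μ n) i j)) (sym (toℕ-enc x)) (sym (toℕ-enc y))
            (Equivalence.from (adj⇔nbr x y) y∈))

-- Green functions on the chains and their transport by automorphisms.

[]-yes : ∀ {p} {P : Set p} (d : Dec P) → P → [ d ] ≡ 1ℚ
[]-yes (yes _) x = refl
[]-yes (no ¬x) x = ⊥-elim (¬x x)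

[]-no : ∀ {p} {P : Set p} (d : Dec P) → ¬ P → [ d ] ≡ 0ℚ
[]-no (yes x) ¬x = ⊥-elim (¬x x)
[]-no (no _)  ¬x = refl

sumV-cong : ∀ {n} {f g : V n → ℚ} → (∀ v → f v ≡ g v) → sumV f ≡ sumV g
sumV-cong h = cong₂ _+_ (sumᶠ-cong λ k → cong₂ _+_ (h (a (false , k))) (h (b (false , k))))
  (cong₂ _+_ (sumᶠ-cong λ k → cong₂ _+_ (h (a (true , k))) (h (b (true , k)))) (sumᶠ-cong λ k → h (w k)))

sumV-dec : ∀ {n} (f : V n → ℚ) → sumV f ≡ sumᶠ (λ i → f (dec {n} i))
sumV-dec {n} f = sym (trans (sumᶠ-enc n (λ i → f (dec i))) (sumV-cong λ v → cong f (dec-enc v)))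

sumV-permute : ∀ {n} (f : V n → ℚ) (π π⁻¹ : V n → V n) → (∀ v → π (π⁻¹ v) ≡ v) → (∀ v → π⁻¹ (π v) ≡ v) →
  sumV f ≡ sumV (λ v → f (π v))
sumV-permute {n} f π π⁻¹ ππ⁻¹ π⁻¹π = begin
  sumV f                                  ≡⟨ sumV-dec f ⟩
  sumᶠ f̂                                  ≡⟨ sumᶠ≡sum (5 ℕ.* n) f̂ ⟩
  ∑.sum f̂
    ≡⟨ ∑.∑-permute f̂ (permutation π̂ π̂⁻¹ (conj π π⁻¹ ππ⁻¹) (conj π⁻¹ π π⁻¹π)) ⟩
  ∑.sum (λ i → f̂ (π̂ i))                   ≡⟨ sumᶠ≡sum (5 ℕ.* n) (λ i → f̂ (π̂ i)) ⟨
  sumᶠ (λ i → f̂ (π̂ i))                    ≡⟨ sumᶠ-cong (λ i → cong f (dec-enc (π (dec i)))) ⟩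
  sumᶠ (λ i → f (π (dec {n} i)))          ≡⟨ sumV-dec (λ v → f (π v)) ⟨
  sumV (λ v → f (π v))                    ∎
  where
  f̂ : Fin (5 ℕ.* n) → ℚ
  f̂ i = f (dec i)
  π̂ π̂⁻¹ : Fin (5 ℕ.* n) → Fin (5 ℕ.* n)
  π̂ i = enc (π (dec i))
  π̂⁻¹ i = enc (π⁻¹ (dec i))
  conj : ∀ (σ τ : V n → V n) → (∀ v → σ (τ v) ≡ v) → ∀ i → enc (σ (dec (enc (τ (dec i))))) ≡ i
  conj σ τ στ i = trans (cong (λ v → enc (σ v)) (dec-enc (τ (dec i)))) (trans (cong enc (στ (dec i))) (enc-dec {n} i))

2ℚ 3ℚ : ℚ
2ℚ = ℤ.+ 2 ℚ./ 1
3ℚ = ℤ.+ 3 ℚ./ 1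

degV : ∀ {n} → V n → ℚ
degV (a _) = 3ℚ
degV (b _) = 3ℚ
degV (w _) = 2ℚ

δV : ∀ {n} → V n → V n → ℚ
δV u v = [ enc u Fin.≟ enc v ]

δV-refl : ∀ {n} (v : V n) → δV v v ≡ 1ℚ
δV-refl v = []-yes (enc v Fin.≟ enc v) refl

δV-≢ : ∀ {n} (u v : V n) → u ≢ v → δV u v ≡ 0ℚ
δV-≢ u v u≢v = []-no (enc u Fin.≟ enc v) (λ eq → u≢v (enc-injective eq))

δV-injective : ∀ {n} (π : V n → V n) → (∀ {u v} → π u ≡ π v → u ≡ v) → ∀ u v → δV (π u) (π v) ≡ δV u v
δV-injective π inj u v = cong (λ t → if t then 1ℚ else 0ℚ)
  (does-⇔ (mk⇔ (λ eq → cong enc (inj (enc-injective eq))) (λ eq → cong (λ x → enc (π x)) (enc-injective eq)))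
    (enc (π u) Fin.≟ enc (π v)) (enc u Fin.≟ enc v))

module ChainGreen (μ : Bool) (l : ℕ) where
  open Chain μ l

  deg-enc : ∀ x → deg (edges μ n) (5 ℕ.* n) (enc x) ≡ degV x
  deg-enc x = trans (sum-adj (λ _ → 1ℚ) x) (count x)
    where
    count : ∀ x → nbrSum (λ _ → 1ℚ) x ≡ degV x
    count (a _) = refl
    count (b _) = refl
    count (w _) = refl

  nbrSum-cong : ∀ {f g} → (∀ v → f v ≡ g v) → ∀ x → nbrSum f x ≡ nbrSum g x
  nbrSum-cong {f} {g} h x = go (nbrs x)
    where
    go : ∀ xs → foldr (λ y acc → f y + acc) 0ℚ xs ≡ foldr (λ y acc → g y + acc) 0ℚ xs
    go []       = refl
    go (y ∷ ys) = cong₂ _+_ (h y) (go ys)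

  lapV : (V n → ℚ) → V n → ℚ
  lapV f x = degV x * f x - nbrSum f x

  lap-dec : ∀ f x → lap (edges μ n) (5 ℕ.* n) (λ i → f (dec {n} i)) (enc x) ≡ lapV f x
  lap-dec f x = cong₂ _-_ (cong₂ _*_ (deg-enc x) (cong f (dec-enc x)))
    (trans (sum-adj (λ i → f (dec i)) x) (nbrSum-cong (λ v → cong f (dec-enc v)) x))

  -- The value at the source is a parameter because it alone enters the index and it is unchanged by
  -- automorphisms.
  record GreenV (c : ℚ) (v : V n) (h : ℚ) : Set where
    field
      pot       : V n → ℚ
      lap-pot   : ∀ u → lapV pot u ≡ δV u v - degV u * c
      centered  : sumV (λ u → degV u * pot u) ≡ 0ℚ
      at-source : pot v ≡ h

  module _ {c : ℚ} {h : V n → ℚ} (g : ∀ v → GreenV c v (h v)) where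
    open GreenV

    green : ∀ i → Green (edges μ n) (5 ℕ.* n) c i
    green i = record
      { pot      = λ k → pot G (dec k)
      ; lap-pot  = λ k → subst (λ k → lap (edges μ n) (5 ℕ.* n) (λ k → pot G (dec k)) k
                                    ≡ [ k Fin.≟ i ] - deg (edges μ n) (5 ℕ.* n) k * c) (enc-dec {n} k)
                                      (at-enc (dec k))
      ; centered = trans (sumᶠ-enc n (λ k → deg (edges μ n) (5 ℕ.* n) k * pot G (dec k)))
          (trans (sumV-cong λ v → cong₂ _*_ (deg-enc v) (cong (pot G) (dec-enc v))) (centered G))
      }
      where
      G : GreenV c (dec i) (h (dec i))
      G = g (dec i)
      at-enc : ∀ x → lap (edges μ n) (5 ℕ.* n) (λ k → pot G (dec k)) (enc x)
                   ≡ [ enc x Fin.≟ i ] - deg (edges μ n) (5 ℕ.* n) (enc x) * c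
      at-enc x = begin
        lap (edges μ n) (5 ℕ.* n) (λ k → pot G (dec k)) (enc x)
          ≡⟨ lap-dec (pot G) x ⟩
        lapV (pot G) x
          ≡⟨ lap-pot G x ⟩
        [ enc x Fin.≟ enc (dec {n} i) ] - degV x * c
          ≡⟨ cong₂ _-_ (cong (λ j → [ enc x Fin.≟ j ]) (enc-dec {n} i)) (cong (_* c) (sym (deg-enc x))) ⟩
        [ enc x Fin.≟ i ] - deg (edges μ n) (5 ℕ.* n) (enc x) * c ∎

    degreeKirchhoffIndex-V :
      IsDegreeKirchhoffIndex (edges μ n) (5 ℕ.* n) (sumV {n} degV * sumV (λ v → degV v * h v))
    degreeKirchhoffIndex-V = subst (IsDegreeKirchhoffIndex (edges μ n) (5 ℕ.* n))
      (cong₂ _*_ (trans (sumᶠ-enc n d) (sumV-cong deg-enc))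
                 (trans (sumᶠ-enc n (λ i → d i * Green.pot (green i) i)) (sumV-cong λ v → cong₂ _*_ (deg-enc v)
                   (trans (at-source (g (dec (enc v)))) (cong h (dec-enc v))))))
      (degreeKirchhoffIndex (edges μ n) (5 ℕ.* n) green)
      where
      d : Fin (5 ℕ.* n) → ℚ
      d = deg (edges μ n) (5 ℕ.* n)

  -- Adjacency is preserved in the form in which it enters the Laplacian. Sums over neighbours also
  -- hide the order of the list, which an automorphism may permute.
  record Automorphism : Set where
    field
      to from     : V n → V n
      to-from     : ∀ v → to (from v) ≡ v
      from-to     : ∀ v → from (to v) ≡ v
      degV-to     : ∀ v → degV (to v) ≡ degV v
      nbrSum-to   : ∀ f v → nbrSum f (to v) ≡ nbrSum (λ u → f (to u)) v

  transport : ∀ {c v h} (π : Automorphism) → GreenV c v h → GreenV c (Automorphism.to π v) h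
  transport {c} {v} {h} π g = record
    { pot       = λ u → pot (from u)
    ; lap-pot   = λ u → subst (λ u → lapV (λ x → pot (from x)) u
         ≡ δV u (to v) - degV u * c) (to-from u) (at-to (from u))
    ; centered  = trans (sumV-permute (λ u → degV u * pot (from u)) to from to-from from-to)
        (trans (sumV-cong λ u → cong₂ _*_ (degV-to u) (cong pot (from-to u))) centered)
    ; at-source = trans (cong pot (from-to v)) at-source
    }
    where
    open Automorphism π
    open GreenV g
    to-injective : ∀ {x y} → to x ≡ to y → x ≡ y
    to-injective eq = trans (sym (from-to _)) (trans (cong from eq) (from-to _))
    at-to : ∀ u → lapV (λ x → pot (from x)) (to u) ≡ δV (to u) (to v) - degV (to u) * c
    at-to u = begin
      lapV (λ x → pot (from x)) (to u)
        ≡⟨ cong₂ _-_ (cong₂ _*_ (degV-to u) (cong pot (from-to u)))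
             (trans (nbrSum-to (λ x → pot (from x)) u) (nbrSum-cong (λ x → cong pot (from-to x)) u)) ⟩
      lapV pot u
        ≡⟨ lap-pot u ⟩
      δV u v - degV u * c
        ≡⟨ cong₂ (λ x d → x - d * c) (δV-injective to to-injective u v) (degV-to u) ⟨
      δV (to u) (to v) - degV (to u) * c ∎

  flip-next : ∀ p → next (flip p) ≡ flip (next p)
  flip-next (s , i) with view i
  ... | ‵fromℕ     = cong (_, Fin.zero) (sym (not-distribˡ-xor s μ))
  ... | ‵inject₁ i = refl

  flip-prev : ∀ p → prev (flip p) ≡ flip (prev p)
  flip-prev (s , Fin.zero)  = cong (_, last) (sym (not-distribˡ-xor s μ))
  flip-prev (s , Fin.suc i) = refl

  -- A vertex `w` carries no strand, so its rotation is computed on strand `false` and must agree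
  -- with the other one.
  cell-next : ∀ s k → proj₂ (next (s , k)) ≡ proj₂ (next (false , k))
  cell-next false k = refl
  cell-next true  k = cong proj₂ (flip-next (false , k))

  cell-prev : ∀ s k → proj₂ (prev (s , k)) ≡ proj₂ (prev (false , k))
  cell-prev s Fin.zero    = refl
  cell-prev s (Fin.suc i) = refl

  -- Reflection, and rotation across a Möbius seam, exchange the two neighbours of a `w` in its
  -- list.
  both-sides : ∀ (f : V n → ℚ) q →
    f (b (false , proj₂ q)) + (f (b (true , proj₂ q)) + 0ℚ) ≡ f (b q) + (f (b (flip q)) + 0ℚ)
  both-sides f (false , k) = refl
  both-sides f (true  , k) = solve 2 (λ x y → x :+ (y :+ con 0ℚ)
    := y :+ (x :+ con 0ℚ)) refl (f (b (false , k))) (f (b (true , k)))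

  rotation : Automorphism
  rotation = record
    { to = to ; from = from ; to-from = to-from ; from-to = from-to ; degV-to = degV-to ; nbrSum-to = nbrSum-to }
    where
    to from : V n → V n
    to (a p) = a (next p)
    to (b p) = b (next p)
    to (w k) = w (proj₂ (next (false , k)))
    from (a p) = a (prev p)
    from (b p) = b (prev p)
    from (w k) = w (proj₂ (prev (false , k)))
    to-from : ∀ v → to (from v) ≡ v
    to-from (a p) = cong a (next-prev p)
    to-from (b p) = cong b (next-prev p)
    to-from (w k) = cong w
      (trans (sym (cell-next (proj₁ (prev (false , k))) (proj₂ (prev (false , k)))))
        (cong proj₂ (next-prev (false , k))))
    from-to : ∀ v → from (to v) ≡ v
    from-to (a p) = cong a (prev-next p)
    from-to (b p) = cong b (prev-next p)
    from-to (w k) = cong w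
      (trans (sym (cell-prev (proj₁ (next (false , k))) (proj₂ (next (false , k)))))
        (cong proj₂ (prev-next (false , k))))
    degV-to : ∀ v → degV (to v) ≡ degV v
    degV-to (a p) = refl
    degV-to (b p) = refl
    degV-to (w k) = refl
    nbrSum-to : ∀ f v → nbrSum f (to v) ≡ nbrSum (λ u → f (to u)) v
    nbrSum-to f (a p) = cong₂ (λ q r → f (b (next p)) + (f (b q) + (f (a r) + 0ℚ)))
      (trans (prev-next p) (sym (next-prev p))) (sym (flip-next p))
    nbrSum-to f (b p) = cong (λ k → f (a (next p)) + (f (a (next (next p))) + (f (w k) + 0ℚ)))
      (cell-next (proj₁ p) (proj₂ p))
    nbrSum-to f (w k) = trans (both-sides f (next (false , k)))
      (cong (λ q → f (b (next (false , k))) + (f (b q) + 0ℚ)) (sym (flip-next (false , k))))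

  flip-flip : ∀ (p : Pos n) → flip (flip p) ≡ p
  flip-flip (s , k) = cong (_, k) (not-involutive s)

  reflection : Automorphism
  reflection = record
    { to = to ; from = to ; to-from = to-to ; from-to = to-to ; degV-to = degV-to ; nbrSum-to = nbrSum-to }
    where
    to : V n → V n
    to (a p) = a (flip p)
    to (b p) = b (flip p)
    to (w k) = w k
    to-to : ∀ v → to (to v) ≡ v
    to-to (a p) = cong a (flip-flip p)
    to-to (b p) = cong b (flip-flip p)
    to-to (w k) = refl
    degV-to : ∀ v → degV (to v) ≡ degV v
    degV-to (a p) = refl
    degV-to (b p) = refl
    degV-to (w k) = refl
    nbrSum-to : ∀ f v → nbrSum f (to v) ≡ nbrSum (λ u → f (to u)) v
    nbrSum-to f (a p) = cong (λ q → f (b (flip p)) + (f (b q) + (f (a (flip (flip p))) + 0ℚ))) (flip-prev p)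
    nbrSum-to f (b p) = cong (λ q → f (a (flip p)) + (f (a q) + (f (w (proj₂ p)) + 0ℚ))) (flip-next p)
    nbrSum-to f (w k) = both-sides f (true , k)

  module _ {c : ℚ} {h : ℚ} where

    -- Reflection reaches the other strand of cell 0, and rotation then carries both strands forward
    -- cell by cell.
    spread : ∀ (x : Pos n → V n) → (∀ p → x (next p) ≡ Automorphism.to rotation (x p)) →
      (∀ p → x (flip p) ≡ Automorphism.to reflection (x p)) →
      GreenV c (x (false , Fin.zero)) h → ∀ p → GreenV c (x p) h
    spread x x-next x-flip g (s , k) = <-weakInduction (λ k → ∀ s → GreenV c (x (s , k)) h) base step k s
      where
      base : ∀ s → GreenV c (x (s , Fin.zero)) h
      base false = g
      base true  = subst (λ v → GreenV c v h) (sym (x-flip (false , Fin.zero))) (transport reflection g)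
      step : ∀ i → (∀ s → GreenV c (x (s , inject₁ i)) h) → ∀ s → GreenV c (x (s , Fin.suc i)) h
      step i ih s = subst (λ p → GreenV c (x p) h) (next-inject₁ s i)
        (subst (λ v → GreenV c v h) (sym (x-next (s , inject₁ i))) (transport rotation (ih s)))

    green-a : GreenV c (a (false , Fin.zero)) h → ∀ p → GreenV c (a p) h
    green-a = spread a (λ _ → refl) (λ _ → refl)

    -- The base source is in the last cell because the equation at a `b` there is the one that
    -- crosses the seam. One rotation brings it to cell 0 on strand `μ`; in the Möbius chain a
    -- reflection brings it back to strand `false`.
    green-b : GreenV c (b (false , last)) h → ∀ p → GreenV c (b p) h
    green-b g = spread b (λ _ → refl) (λ _ → refl)
      (start μ (subst (λ p → GreenV c (b p) h) (next-last false) (transport rotation g)))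
      where
      start : ∀ s → GreenV c (b (s , Fin.zero)) h → GreenV c (b (false , Fin.zero)) h
      start false g = g
      start true  g = transport reflection g

    green-w : GreenV c (w last) h → ∀ k → GreenV c (w k) h
    green-w g k = spread (λ p → w (proj₂ p)) (λ p → cong w (cell-next (proj₁ p) (proj₂ p))) (λ _ → refl)
      (subst (λ p → GreenV c (w (proj₂ p)) h) (next-last false) (transport rotation g)) (false , k)

-- Splitting a potential into symmetric and antisymmetric parts.

sg : Bool → ℚ
sg false = 1ℚ
sg true  = - 1ℚ

sg-xor : ∀ s t → sg (s xor t) ≡ sg s * sg t
sg-xor false false = refl
sg-xor false true  = refl
sg-xor true  false = refl
sg-xor true  true  = refl

sg-not : ∀ s → sg (not s) ≡ - sg s
sg-not false = refl
sg-not true  = refl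

4ℚ 6ℚ 8ℚ : ℚ
4ℚ = ℤ.+ 4 ℚ./ 1
6ℚ = ℤ.+ 6 ℚ./ 1
8ℚ = ℤ.+ 8 ℚ./ 1

-- The part of a potential that is symmetric in the two strands takes the
-- values S k and B k on the k-th cell, the antisymmetric part α k and β k;
-- z is the last cell and ε the sign picked up on going once around.  The
-- sources are Ja at a (false , 0), Jb at b (false , z) and Jw at w z; half of
-- Ja and of Jb goes to the symmetric part and half to the antisymmetric one.
record Profile (N : ℕ) (ε c Ja Jb Jw : ℚ) (z : ℕ) : Set where
  field
    S B α β : ℕ → ℚ
    sym-a   : ∀ k → 2ℚ * S (suc k) - B (suc k) - B k ≡ - (3ℚ * c)
    sym-b   : ∀ k → 2ℚ * B k - S k - S (suc k) + 4ℚ * c ≡ 0ℚ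
    sym-a₀  : 2ℚ * S 0 - B 0 - B z ≡ Ja * ½ - 3ℚ * c
    sym-bz  : 2ℚ * B z - S z - S 0 + 4ℚ * c ≡ (Jb + Jw) * ½
    anti-a  : ∀ k → 4ℚ * α (suc k) - β (suc k) ≡ β k
    anti-b  : ∀ k → 3ℚ * β k - α k ≡ α (suc k)
    anti-a₀ : 4ℚ * α 0 - β 0 ≡ ε * β z + Ja * ½
    anti-bz : 3ℚ * β z - α z ≡ ε * α 0 + Jb * ½
    balance : sumᶠ {N} (λ k → 6ℚ * S (toℕ k) + 8ℚ * B (toℕ k) - 2ℚ * c) + Jw ≡ 0ℚ

-- Terms without a strand sign form the symmetric equation, the signed ones the antisymmetric
-- equation. The rung joins opposite signs, which turns the degree 3 into 2 for `S` and 4 for `α`;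
-- `σ′` is the sign in the preceding cell, different from `σ` only across a Möbius seam.
stencil-a : ∀ S B B′ α β β′ σ σ′ →
  3ℚ * (S + σ * α) - ((B + σ * β) + ((B′ + σ′ * β′) + ((S + (- σ) * α) + 0ℚ)))
  ≡ (2ℚ * S - B - B′) + (σ * (4ℚ * α - β) - σ′ * β′)
stencil-a = solve 8 (λ S B B′ α β β′ σ σ′ →
  con 3ℚ :* (S :+ σ :* α) :- ((B :+ σ :* β) :+ ((B′ :+ σ′ :* β′) :+ ((S :+ (:- σ) :* α) :+ con 0ℚ)))
  := (con 2ℚ :* S :- B :- B′) :+ (σ :* (con 4ℚ :* α :- β) :- σ′ :* β′)) refl

-- The neighbour `w` is already eliminated as `B - c + e`. It has no antisymmetric part, so the
-- degree 3 becomes 2 for `B` and stays 3 for `β`; its `- c` joins the 3c of the vertex to give 4c.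
stencil-b : ∀ S S′ B α α′ β σ σ′ c e →
  3ℚ * (B + σ * β) - ((S + σ * α) + ((S′ + σ′ * α′) + ((B - c + e) + 0ℚ)))
  ≡ (2ℚ * B - S - S′ + 4ℚ * c) + (σ * (3ℚ * β - α) - σ′ * α′) - e - 3ℚ * c
stencil-b = solve 10 (λ S S′ B α α′ β σ σ′ c e →
  con 3ℚ :* (B :+ σ :* β) :- ((S :+ σ :* α) :+ ((S′ :+ σ′ :* α′) :+ ((B :- c :+ e) :+ con 0ℚ)))
  := (con 2ℚ :* B :- S :- S′ :+ con 4ℚ :* c) :+ (σ :* (con 3ℚ :* β :- α) :- σ′ :* α′) :- e :- con 3ℚ :* c) refl

stencil-w : ∀ B β c J i →
  2ℚ * (B - c + J * ½ * i) - ((B + 1ℚ * β) + ((B + (- 1ℚ) * β) + 0ℚ)) ≡ J * i - 2ℚ * c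
stencil-w = solve 5 (λ B β c J i →
  con 2ℚ :* (B :- c :+ J :* con ½ :* i) :- ((B :+ con 1ℚ :* β) :+ ((B :+ con (- 1ℚ) :* β) :+ con 0ℚ))
  := J :* i :- con 2ℚ :* c) refl

module ChainPotential (μ : Bool) (l : ℕ) where
  open Chain μ l
  open ChainGreen μ l

  ε : ℚ
  ε = sg μ

  module _ {c Ja Jb Jw : ℚ} (P : Profile n ε c Ja Jb Jw (toℕ last)) where
    open Profile P

    at-last : Fin n → ℚ
    at-last k = [ k Fin.≟ last ]

    potential : V n → ℚ
    potential (a (s , k)) = S (toℕ k) + sg s * α (toℕ k)
    potential (b (s , k)) = B (toℕ k) + sg s * β (toℕ k)
    -- Solved from the equation at `w k`: its two neighbours have mean `B`, and half of its net
    -- source is added.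
    potential (w k)       = B (toℕ k) - c + Jw * ½ * at-last k

    source : V n → ℚ
    -- The factor ½ (1 + sign) adds the symmetric and antisymmetric halves: it is 1 on strand
    -- `false` and 0 on strand `true`.
    source (a (s , Fin.zero))  = Ja * ½ * (1ℚ + sg s)
    source (a (s , Fin.suc _)) = 0ℚ
    source (b (s , k))         = Jb * ½ * (1ℚ + sg s) * at-last k
    source (w k)               = Jw * at-last k

    lap-a : ∀ s k → lapV potential (a (s , k)) ≡ source (a (s , k)) - 3ℚ * c
    lap-a s Fin.zero = begin
      lapV potential (a (s , Fin.zero))
        ≡⟨ cong₂ (λ σ τ → 3ℚ * (S 0 + sg s * α 0)
             - ((B 0 + sg s * β 0) + ((B (toℕ last) + σ * β (toℕ last)) + ((S 0 + τ * α 0) + 0ℚ))))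
             (sg-xor s μ) (sg-not s) ⟩
      3ℚ * (S 0 + sg s * α 0)
        - ((B 0 + sg s * β 0) + ((B (toℕ last) + sg s * ε * β (toℕ last)) + ((S 0 + (- sg s) * α 0) + 0ℚ)))
        ≡⟨ stencil-a (S 0) (B 0) (B (toℕ last)) (α 0) (β 0) (β (toℕ last)) (sg s) (sg s * ε) ⟩
      (2ℚ * S 0 - B 0 - B (toℕ last)) + (sg s * (4ℚ * α 0 - β 0) - sg s * ε * β (toℕ last))
        ≡⟨ cong₂ (λ x y → x + (sg s * y - sg s * ε * β (toℕ last))) sym-a₀ anti-a₀ ⟩
      (Ja * ½ - 3ℚ * c) + (sg s * (ε * β (toℕ last) + Ja * ½) - sg s * ε * β (toℕ last))
        ≡⟨ solve 5 (λ J c σ e β → (J :* con ½ :- con 3ℚ :* c) :+ (σ :* (e :* β :+ J :* con ½) :- σ :* e :* β)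
             := J :* con ½ :* (con 1ℚ :+ σ) :- con 3ℚ :* c) refl Ja c (sg s) ε (β (toℕ last)) ⟩
      Ja * ½ * (1ℚ + sg s) - 3ℚ * c ∎
    lap-a s (Fin.suc i) = begin
      lapV potential (a (s , Fin.suc i))
        ≡⟨ cong₂ (λ j τ → 3ℚ * (S (suc k) + sg s * α (suc k))
             - ((B (suc k) + sg s * β (suc k)) + ((B j + sg s * β j) + ((S (suc k) + τ * α (suc k)) + 0ℚ))))
             (toℕ-inject₁ i) (sg-not s) ⟩
      3ℚ * (S (suc k) + sg s * α (suc k))
        - ((B (suc k) + sg s * β (suc k)) + ((B k + sg s * β k) + ((S (suc k) + (- sg s) * α (suc k)) + 0ℚ)))
        ≡⟨ stencil-a (S (suc k)) (B (suc k)) (B k) (α (suc k)) (β (suc k)) (β k) (sg s) (sg s) ⟩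
      (2ℚ * S (suc k) - B (suc k) - B k) + (sg s * (4ℚ * α (suc k) - β (suc k)) - sg s * β k)
        ≡⟨ cong₂ (λ x y → x + (sg s * y - sg s * β k)) (sym-a k) (anti-a k) ⟩
      - (3ℚ * c) + (sg s * β k - sg s * β k)
        ≡⟨ solve 2 (λ c x → :- (con 3ℚ :* c) :+ (x :- x) := con 0ℚ :- con 3ℚ :* c) refl c (sg s * β k) ⟩
      0ℚ - 3ℚ * c ∎
      where
      k : ℕ
      k = toℕ i

    stencilB : Bool → Fin n → Pos n → ℚ → ℚ
    stencilB s k q i = 3ℚ * (B (toℕ k) + sg s * β (toℕ k))
      - ((S (toℕ k) + sg s * α (toℕ k)) + (potential (a q) + ((B (toℕ k) - c + Jw * ½ * i) + 0ℚ)))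

    lap-b-last : ∀ s → lapV potential (b (s , last)) ≡ source (b (s , last)) - 3ℚ * c
    lap-b-last s = begin
      lapV potential (b (s , last))
        ≡⟨ cong₂ (stencilB s last) (next-last s) ([]-yes (last Fin.≟ last) refl) ⟩
      stencilB s last (s xor μ , Fin.zero) 1ℚ
        ≡⟨ cong (λ σ → 3ℚ * (B z + sg s * β z)
             - ((S z + sg s * α z) + ((S 0 + σ * α 0) + ((B z - c + Jw * ½ * 1ℚ) + 0ℚ)))) (sg-xor s μ) ⟩
      3ℚ * (B z + sg s * β z) - ((S z + sg s * α z) + ((S 0 + sg s * ε * α 0) + ((B z - c + Jw * ½ * 1ℚ) + 0ℚ)))
        ≡⟨ stencil-b (S z) (S 0) (B z) (α z) (α 0) (β z) (sg s) (sg s * ε) c (Jw * ½ * 1ℚ) ⟩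
      (2ℚ * B z - S z - S 0 + 4ℚ * c) + (sg s * (3ℚ * β z - α z) - sg s * ε * α 0) - Jw * ½ * 1ℚ - 3ℚ * c
        ≡⟨ cong₂ (λ x y → x + (sg s * y - sg s * ε * α 0) - Jw * ½ * 1ℚ - 3ℚ * c) sym-bz anti-bz ⟩
      (Jb + Jw) * ½ + (sg s * (ε * α 0 + Jb * ½) - sg s * ε * α 0) - Jw * ½ * 1ℚ - 3ℚ * c
        ≡⟨ solve 6 (λ J K c σ e α → (J :+ K) :* con ½ :+ (σ :* (e :* α :+ J :* con ½) :- σ :* e :* α) :- K :*
             con ½ :* con 1ℚ :- con 3ℚ :* c
             := J :* con ½ :* (con 1ℚ :+ σ) :* con 1ℚ :- con 3ℚ :* c) refl Jb Jw c (sg s) ε (α 0) ⟩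
      Jb * ½ * (1ℚ + sg s) * 1ℚ - 3ℚ * c
        ≡⟨ cong (λ i → Jb * ½ * (1ℚ + sg s) * i - 3ℚ * c) ([]-yes (last Fin.≟ last) refl) ⟨
      source (b (s , last)) - 3ℚ * c ∎
      where
      z : ℕ
      z = toℕ last

    inject₁≢last : ∀ (i : Fin m) → ¬ inject₁ i ≡ last
    inject₁≢last i eq = fromℕ≢inject₁ (sym eq)

    lap-b-inject₁ : ∀ s i → lapV potential (b (s , inject₁ i)) ≡ source (b (s , inject₁ i)) - 3ℚ * c
    lap-b-inject₁ s i = begin
      lapV potential (b (s , inject₁ i))
        ≡⟨ cong₂ (stencilB s (inject₁ i)) (next-inject₁ s i) ([]-no (inject₁ i Fin.≟ last) (inject₁≢last i)) ⟩
      stencilB s (inject₁ i) (s , Fin.suc i) 0ℚ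
        -- The next cell is indexed by `suc (toℕ i)`, this one by `toℕ (inject₁ i)`; both must be
        -- written with the same `k` before the recursion applies.
        ≡⟨ cong (λ j → 3ℚ * (B k + sg s * β k)
             - ((S k + sg s * α k) + ((S (suc j) + sg s * α (suc j)) + ((B k - c + Jw * ½ * 0ℚ) + 0ℚ))))
               (sym (toℕ-inject₁ i)) ⟩
      3ℚ * (B k + sg s * β k)
        - ((S k + sg s * α k) + ((S (suc k) + sg s * α (suc k)) + ((B k - c + Jw * ½ * 0ℚ) + 0ℚ)))
        ≡⟨ stencil-b (S k) (S (suc k)) (B k) (α k) (α (suc k)) (β k) (sg s) (sg s) c (Jw * ½ * 0ℚ) ⟩
      (2ℚ * B k - S k - S (suc k) + 4ℚ * c) + (sg s * (3ℚ * β k - α k) - sg s * α (suc k)) - Jw * ½ * 0ℚ - 3ℚ * c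
        ≡⟨ cong₂ (λ x y → x + (sg s * y - sg s * α (suc k)) - Jw * ½ * 0ℚ - 3ℚ * c) (sym-b k) (anti-b k) ⟩
      0ℚ + (sg s * α (suc k) - sg s * α (suc k)) - Jw * ½ * 0ℚ - 3ℚ * c
        ≡⟨ solve 5 (λ J K c σ x → con 0ℚ :+ (x :- x) :- K :* con ½ :* con 0ℚ :- con 3ℚ :* c
             := J :* con ½ :* (con 1ℚ :+ σ) :* con 0ℚ :- con 3ℚ :* c) refl Jb Jw c (sg s) (sg s * α (suc k)) ⟩
      Jb * ½ * (1ℚ + sg s) * 0ℚ - 3ℚ * c
        ≡⟨ cong (λ i → Jb * ½ * (1ℚ + sg s) * i - 3ℚ * c) ([]-no (inject₁ i Fin.≟ last) (inject₁≢last i)) ⟨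
      source (b (s , inject₁ i)) - 3ℚ * c ∎
      where
      k : ℕ
      k = toℕ (inject₁ i)

    lap-b : ∀ s {k} → View k → lapV potential (b (s , k)) ≡ source (b (s , k)) - 3ℚ * c
    lap-b s ‵fromℕ           = lap-b-last s
    lap-b s (‵inj₁ {i = i} _) = lap-b-inject₁ s i

    lapV-potential : ∀ u → lapV potential u ≡ source u - degV u * c
    lapV-potential (a (s , k)) = lap-a s k
    lapV-potential (b (s , k)) = lap-b s (view k)
    lapV-potential (w k)       = stencil-w (B (toℕ k)) (β (toℕ k)) c Jw (at-last k)

    -- The antisymmetric parts cancel between the strands. Per cell, `S` keeps weight 3 + 3 and `B`
    -- weight 3 + 3 + 2, the 2 coming from `w`.
    potential-centered : sumV (λ u → degV u * potential u) ≡ 0ℚ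
    potential-centered = begin
      sumV (λ u → degV u * potential u)
        ≡⟨ cong (sumᶠ (strand false) +_) (sumᶠ-+ n (strand true) (λ k → 2ℚ * potential (w k))) ⟨
      sumᶠ (strand false) + sumᶠ (λ k → strand true k + 2ℚ * potential (w k))
        ≡⟨ sumᶠ-+ n (strand false) (λ k → strand true k + 2ℚ * potential (w k)) ⟨
      sumᶠ (λ k → strand false k + (strand true k + 2ℚ * potential (w k)))
        ≡⟨ sumᶠ-cong (λ k → cell (S (toℕ k)) (B (toℕ k)) (α (toℕ k)) (β (toℕ k)) (at-last k)) ⟩
      sumᶠ (λ k → total k + at-last k * Jw)
        ≡⟨ sumᶠ-+ n total (λ k → at-last k * Jw) ⟩
      sumᶠ total + sumᶠ (λ k → at-last k * Jw)
        ≡⟨ cong (sumᶠ total +_) (sumᶠ-unit n last (λ _ → Jw)) ⟩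
      sumᶠ total + Jw
        ≡⟨ balance ⟩
      0ℚ ∎
      where
      strand : Bool → Fin n → ℚ
      strand s k = 3ℚ * potential (a (s , k)) + 3ℚ * potential (b (s , k))
      total : Fin n → ℚ
      total k = 6ℚ * S (toℕ k) + 8ℚ * B (toℕ k) - 2ℚ * c
      cell : ∀ S B α β i →
        (3ℚ * (S + 1ℚ * α) + 3ℚ * (B + 1ℚ * β)) +
          ((3ℚ * (S + (- 1ℚ) * α) + 3ℚ * (B + (- 1ℚ) * β)) + 2ℚ * (B - c + Jw * ½ * i))
        ≡ 6ℚ * S + 8ℚ * B - 2ℚ * c + i * Jw
      cell S B α β i = solve 7 (λ S B α β i c J →
        (con 3ℚ :* (S :+ con 1ℚ :* α) :+ con 3ℚ :* (B :+ con 1ℚ :* β)) :+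
          ((con 3ℚ :* (S :+ con (- 1ℚ) :* α) :+ con 3ℚ :* (B :+ con (- 1ℚ) :* β)) :+ con 2ℚ :*
            (B :- c :+ J :* con ½ :* i))
        := con 6ℚ :* S :+ con 8ℚ :* B :- con 2ℚ :* c :+ i :* J) refl S B α β i c Jw

    potential-GreenV : ∀ {v h} → (∀ u → source u ≡ δV u v) → potential v ≡ h → GreenV c v h
    potential-GreenV {v} src at = record
      { pot       = potential
      ; lap-pot   = λ u → trans (lapV-potential u) (cong (_- degV u * c) (src u))
      ; centered  = potential-centered
      ; at-source = at
      }

  GreenV-a : ∀ {c} (P : Profile n ε c 1ℚ 0ℚ 0ℚ (toℕ last)) → let open Profile P in
    GreenV c (a (false , Fin.zero)) (S 0 + α 0)
  GreenV-a P = potential-GreenV P src (cong (S 0 +_) (*-identityˡ (α 0)))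
    where
    open Profile P
    src : ∀ u → source P u ≡ δV u (a (false , Fin.zero))
    src (a (false , Fin.zero))  = sym (δV-refl {n} (a (false , Fin.zero)))
    src (a (true  , Fin.zero))  = sym (δV-≢ {n} (a (true , Fin.zero)) (a (false , Fin.zero)) (λ ()))
    src (a (s , Fin.suc i))     = sym (δV-≢ {n} (a (s , Fin.suc i)) (a (false , Fin.zero)) (λ ()))
    src (b (s , k))             = trans (solve 2 (λ x y → con 0ℚ :* con ½ :* x :* y
      := con 0ℚ) refl (1ℚ + sg s) (at-last P k)) (sym (δV-≢ {n} (b (s , k)) (a (false , Fin.zero)) (λ ())))
    src (w k)                   = trans (*-zeroˡ (at-last P k)) (sym (δV-≢ {n} (w k) (a (false , Fin.zero)) (λ ())))

  GreenV-b : ∀ {c} (P : Profile n ε c 0ℚ 1ℚ 0ℚ (toℕ last)) → let open Profile P in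
    GreenV c (b (false , last)) (B (toℕ last) + β (toℕ last))
  GreenV-b P = potential-GreenV P src (cong (B (toℕ last) +_) (*-identityˡ (β (toℕ last))))
    where
    open Profile P
    on-strand : ∀ k → at-last P k ≡ δV (b (false , k)) (b (false , last))
    on-strand k = cong (λ t → if t then 1ℚ else 0ℚ) (does-⇔ (mk⇔ (cong (λ k → enc (b (false , k))))
      (λ eq → cong proj₂ (b-injective (enc-injective {n} {b (false , k)} {b (false , last)} eq))))
        (k Fin.≟ last) (enc (b (false , k)) Fin.≟ enc (b (false , last))))
    src : ∀ u → source P u ≡ δV u (b (false , last))
    src (a (s , Fin.zero))  =
      trans (*-zeroˡ (1ℚ + sg s)) (sym (δV-≢ {n} (a (s , Fin.zero)) (b (false , last)) (λ ())))
    src (a (s , Fin.suc i)) = sym (δV-≢ {n} (a (s , Fin.suc i)) (b (false , last)) (λ ()))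
    src (b (false , k))     = trans (*-identityˡ (at-last P k)) (on-strand k)
    src (b (true , k))      = trans (*-zeroˡ (at-last P k)) (sym (δV-≢ {n} (b (true , k)) (b (false , last)) (λ ())))
    src (w k)               = trans (*-zeroˡ (at-last P k)) (sym (δV-≢ {n} (w k) (b (false , last)) (λ ())))

  GreenV-w : ∀ {c} (P : Profile n ε c 0ℚ 0ℚ 1ℚ (toℕ last)) → let open Profile P in
    GreenV c (w last) (B (toℕ last) - c + ½)
  GreenV-w {c} P = potential-GreenV P src (cong (λ i → B (toℕ last) - c + ½ * i) ([]-yes (last Fin.≟ last) refl))
    where
    open Profile P
    src : ∀ u → source P u ≡ δV u (w last)
    src (a (s , Fin.zero))  = trans (*-zeroˡ (1ℚ + sg s)) (sym (δV-≢ {n} (a (s , Fin.zero)) (w last) (λ ())))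
    src (a (s , Fin.suc i)) = sym (δV-≢ {n} (a (s , Fin.suc i)) (w last) (λ ()))
    src (b (s , k))         = trans (solve 2 (λ x y → con 0ℚ :* con ½ :* x :* y
      := con 0ℚ) refl (1ℚ + sg s) (at-last P k)) (sym (δV-≢ {n} (b (s , k)) (w last) (λ ())))
    src (w k)               = trans (*-identityˡ (at-last P k))
      (cong (λ t → if t then 1ℚ else 0ℚ) (does-⇔ (mk⇔ (cong (λ k → enc (w k)))
      (λ eq → w-injective (enc-injective {n} {w k} {w last} eq))) (k Fin.≟ last) (enc (w k) Fin.≟ enc (w last))))
      where
      w-injective : ∀ {i j : Fin n} → w i ≡ w j → i ≡ j
      w-injective refl = refl

-- Explicit solutions by quadratics and Pell numbers.

-- Recursive, so that `nat (suc k)` computes to `1ℚ + nat k` and the ring solver sees the shift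
-- between cells.
nat : ℕ → ℚ
nat zero    = 0ℚ
nat (suc k) = 1ℚ + nat k

⅓ ¼ 5ℚ 7ℚ 12ℚ 14ℚ 19ℚ 21ℚ 42ℚ 49ℚ : ℚ
⅓ = ℤ.+ 1 ℚ./ 3
¼ = ℤ.+ 1 ℚ./ 4
5ℚ = ℤ.+ 5 ℚ./ 1
7ℚ = ℤ.+ 7 ℚ./ 1
12ℚ = ℤ.+ 12 ℚ./ 1
14ℚ = ℤ.+ 14 ℚ./ 1
19ℚ = ℤ.+ 19 ℚ./ 1
21ℚ = ℤ.+ 21 ℚ./ 1
42ℚ = ℤ.+ 42 ℚ./ 1
49ℚ = ℤ.+ 49 ℚ./ 1

-- pellA k + pellB k √6 = (5 + 2√6)^k
pellA pellB : ℕ → ℚ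
pellA zero    = 1ℚ
pellA (suc k) = 5ℚ * pellA k + 12ℚ * pellB k
pellB zero    = 0ℚ
pellB (suc k) = 2ℚ * pellA k + 5ℚ * pellB k

-- The norm of 5 + 2√6 is 25 - 24 = 1, and norms are multiplicative.
pell : ∀ k → pellA k * pellA k - 6ℚ * (pellB k * pellB k) ≡ 1ℚ
pell zero    = refl
pell (suc k) = trans (solve 2 (λ x y →
    (con 5ℚ :* x :+ con 12ℚ :* y) :* (con 5ℚ :* x :+ con 12ℚ :* y) :- con 6ℚ :*
      ((con 2ℚ :* x :+ con 5ℚ :* y) :* (con 2ℚ :* x :+ con 5ℚ :* y))
    := x :* x :- con 6ℚ :* (y :* y)) refl (pellA k) (pellB k)) (pell k)

-- D stands for 1 / 4 (pellA n - ε), with ε = 1 for the cylinder, -1 for the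
-- Möbius chain; it makes the antisymmetric potentials have the right jump.
kfClosed : ℕ → ℚ → ℚ
kfClosed n D = 14ℚ * nat n *
  ((49ℚ * (nat n * nat n) + 42ℚ * nat n - 19ℚ) * (ℤ.+ 1 ℚ./ 42) + 21ℚ * nat n * pellB n * D)

sumᶠ-telescope : ∀ n (F f : ℕ → ℚ) → (∀ k → F (suc k) ≡ F k + f k) → sumᶠ {n} (λ k → f (toℕ k)) ≡ F n - F 0
sumᶠ-telescope zero    F f step = solve 1 (λ x → con 0ℚ := x :- x) refl (F 0)
sumᶠ-telescope (suc n) F f step = begin
  f 0 + sumᶠ {n} (λ k → f (suc (toℕ k)))
    ≡⟨ cong (f 0 +_) (sumᶠ-telescope n (λ k → F (suc k)) (λ k → f (suc k)) (λ k → step (suc k))) ⟩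
  f 0 + (F (suc n) - F 1)
    ≡⟨ cong (λ x → f 0 + (F (suc n) - x)) (step 0) ⟩
  f 0 + (F (suc n) - (F 0 + f 0))
    ≡⟨ solve 3 (λ x y z → x :+ (y :- (z :+ x)) := y :- z) refl (f 0) (F (suc n)) (F 0) ⟩
  F (suc n) - F 0 ∎

-- Counterparts, for the ring solver, of quad, G, q and the Pell recursion.
quadᵖ : ∀ {k} (c N A t : Polynomial k) → Polynomial k
quadᵖ c N A t = con 7ℚ :* c :* (t :* (t :- N)) :+ A

Gᵖ : ∀ {k} (N t : Polynomial k) → Polynomial k
Gᵖ N t = con ½ :* (con ⅓ :* (t :* (t :- con 1ℚ) :* (con 2ℚ :* t :- con 1ℚ)) :- N :* (t :* (t :- con 1ℚ)))

qᵖ : ∀ {k} (an bn e κ x y : Polynomial k) → Polynomial k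
qᵖ an bn e κ x y = κ :* (bn :* x :- (an :- e) :* y)

A′ᵖ B′ᵖ : ∀ {k} (x y : Polynomial k) → Polynomial k
A′ᵖ x y = con 5ℚ :* x :+ con 12ℚ :* y
B′ᵖ x y = con 2ℚ :* x :+ con 5ℚ :* y

module Sequences (m : ℕ) (ε c D : ℚ) where

  n : ℕ
  n = suc m

  N an bn : ℚ
  N  = nat n
  an = pellA n
  bn = pellB n

  -- Half the second difference 14c gives the leading coefficient; the roots 0 and `N` of the
  -- non-constant term make the values agree after one turn, which the symmetric part needs in both
  -- chains.
  quad : ℚ → ℚ → ℚ
  quad A t = 7ℚ * c * (t * (t - N)) + A

  -- Satisfies q (k + 2) = 10 q (k + 1) - q k and q n = ε q 0.
  q : ℚ → ℕ → ℚ
  q κ k = κ * (bn * pellA k - (an - ε) * pellB k)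

  -- G (nat k) is the sum of j (j - N) over j < k.
  G : ℚ → ℚ
  G t = ½ * (⅓ * (t * (t - 1ℚ) * (2ℚ * t - 1ℚ)) - N * (t * (t - 1ℚ)))

  -- The additive constants that make the potentials orthogonal to the degrees.
  Aa Ab : ℚ
  Aa = c * (49ℚ * (N * N) + 5ℚ) * ⅓ * ½ * (ℤ.+ 1 ℚ./ 7)
  Ab = c * (49ℚ * (N * N) - 16ℚ) * ⅓ * ½ * (ℤ.+ 1 ℚ./ 7)
    where
    16ℚ : ℚ
    16ℚ = ℤ.+ 16 ℚ./ 1

  module _ (ε² : ε * ε ≡ 1ℚ) (cN : c * (14ℚ * N) ≡ 1ℚ) (D-inv : D * (4ℚ * (an - ε)) ≡ 1ℚ) where

    3/2 : ℚ
    3/2 = ℤ.+ 3 ℚ./ 2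

    -- The source is at an `a`, so `S` and `α` are the sampled sequences, while `B` and `β` are
    -- obtained by solving `sym-b` and `anti-b` for them.
    profile-a : Profile n ε c 1ℚ 0ℚ 0ℚ m
    profile-a = record
      { S = S ; B = B ; α = α ; β = β
      ; sym-a   = λ k → solve 4 (λ t N c A → let Q = quadᵖ c N A in
          con 2ℚ :* Q (con 1ℚ :+ t)
            :- (con ½ :* (Q (con 1ℚ :+ t) :+ Q (con 1ℚ :+ (con 1ℚ :+ t))) :- con 2ℚ :* c)
              :- (con ½ :* (Q t :+ Q (con 1ℚ :+ t)) :- con 2ℚ :* c)
          := :- (con 3ℚ :* c)) refl (nat k) N c Aa
      ; sym-b   = λ k → solve 3
           (λ x y c → con 2ℚ :* (con ½ :* (x :+ y) :- con 2ℚ :* c) :- x :- y :+ con 4ℚ :* c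
             := con 0ℚ) refl (S k) (S (suc k)) c
      -- The slopes of the quadratic at the two ends of the turn are opposite; their mismatch
      -- supplies `c * (14ℚ * N) * ½`, the symmetric half of the unit source.
      ; sym-a₀  = trans (solve 3 (λ t c A → let N = con 1ℚ :+ t ; Q = quadᵖ c N A in
          con 2ℚ :* Q (con 0ℚ) :- (con ½ :* (Q (con 0ℚ) :+ Q (con 1ℚ :+ con 0ℚ)) :- con 2ℚ :* c)
            :- (con ½ :* (Q t :+ Q (con 1ℚ :+ t)) :- con 2ℚ :* c)
          := c :* (con 14ℚ :* N) :* con ½ :- con 3ℚ :* c) refl (nat m) c Aa) (cong (λ x → x * ½ - 3ℚ * c) cN)
      ; sym-bz  = solve 3 (λ t c A → let N = con 1ℚ :+ t ; Q = quadᵖ c N A in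
          con 2ℚ :* (con ½ :* (Q t :+ Q (con 1ℚ :+ t)) :- con 2ℚ :* c) :- Q t :- Q (con 0ℚ) :+ con 4ℚ :* c
          := (con 0ℚ :+ con 0ℚ) :* con ½) refl (nat m) c Aa
      ; anti-a  = λ k → solve 6 (λ x y an bn e κ → let q = qᵖ an bn e κ ; x′ = A′ᵖ x y ; y′ = B′ᵖ x y in
          con 4ℚ :* q x′ y′ :- con ⅓ :*
            (q x′ y′ :+ q (A′ᵖ x′ y′) (B′ᵖ x′ y′))
              := con ⅓ :* (q x y :+ q x′ y′))
          refl (pellA k) (pellB k) an bn ε κ
      ; anti-b  = λ k → solve 2 (λ x y → con 3ℚ :* (con ⅓ :* (x :+ y)) :- x := y) refl (α k) (α (suc k))
      ; anti-a₀ = begin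
          4ℚ * α 0 - β 0
            -- The Pell norm and `ε²` are not ring identities, so their defects from 1 are displayed
            -- as explicit multiples, which the following steps cancel.
            ≡⟨ solve 4 (λ x y e κ → let an = A′ᵖ x y ; bn = B′ᵖ x y ; q = qᵖ an bn e κ ; o = con 1ℚ ; z = con 0ℚ in
               con 4ℚ :* q o z :- con ⅓ :* (q o z :+ q (A′ᵖ o z) (B′ᵖ o z))
               := e :* (con ⅓ :* (q x y :+ q an bn)) :+ con ⅓ :* (κ :* (con 4ℚ :* (an :- e)))
                  :- con ⅓ :* (con 2ℚ :* κ :* e :* ((x :* x :- con 6ℚ :* (y :* y)) :- con 1ℚ)) :- con ⅓ :*
                    (κ :* (y :+ bn) :* (e :* e :- con 1ℚ)))
               refl (pellA m) (pellB m) ε κ ⟩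
          ε * β m + ⅓ * (κ * (4ℚ * (an - ε))) - ⅓ *
            (2ℚ * κ * ε * ((pellA m * pellA m - 6ℚ * (pellB m * pellB m)) - 1ℚ)) - ⅓ *
              (κ * (pellB m + bn) * (ε * ε - 1ℚ))
            ≡⟨ cong₂ (λ x y → ε * β m + ⅓ * (κ * (4ℚ * (an - ε))) - ⅓ * (2ℚ * κ * ε * (x - 1ℚ)) - ⅓ *
                 (κ * (pellB m + bn) * (y - 1ℚ))) (pell m) ε² ⟩
          ε * β m + ⅓ * (κ * (4ℚ * (an - ε))) - ⅓ * (2ℚ * κ * ε * (1ℚ - 1ℚ)) - ⅓ * (κ * (pellB m + bn) * (1ℚ - 1ℚ))
            ≡⟨ solve 5 (λ X D Y u v → X :+ con ⅓ :* (con 3/2 :* D :* Y) :- con ⅓ :* (u :* (con 1ℚ :- con 1ℚ))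
                 :- con ⅓ :* (v :* (con 1ℚ :- con 1ℚ)) := X :+ con ½ :* (D :* Y))
                 refl (ε * β m) D (4ℚ * (an - ε)) (2ℚ * κ * ε) (κ * (pellB m + bn)) ⟩
          ε * β m + ½ * (D * (4ℚ * (an - ε)))
            ≡⟨ cong (λ x → ε * β m + ½ * x) D-inv ⟩
          ε * β m + 1ℚ * ½ ∎
      -- By the choice of `β`, the left side is `α n`, which equals `ε * α 0`.
      ; anti-bz = solve 6 (λ x y an bn e κ → let q = qᵖ an bn e κ in
          con 3ℚ :* (con ⅓ :* (q x y :+ q an bn)) :- q x y
            := e :* q (con 1ℚ) (con 0ℚ) :+ con 0ℚ :* con ½) refl (pellA m) (pellB m) an bn ε κ
      ; balance = trans (cong (_+ 0ℚ)
           (sumᶠ-telescope n (λ k → F (nat k)) (λ k → 6ℚ * S k + 8ℚ * B k - 2ℚ * c) F-step)) F-total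
      }
      where
      κ : ℚ
      -- Across the seam `q κ` has the defect 4κ(an - ε). The factor ⅓ in `β` divides it by 3, and
      -- the result must be ½.
      κ = 3/2 * D
      S B α β : ℕ → ℚ
      S k = quad Aa (nat k)
      B k = ½ * (S k + S (suc k)) - 2ℚ * c
      α = q κ
      β k = ⅓ * (α k + α (suc k))
      -- F (nat k) is the sum over the first k cells in balance.
      F : ℚ → ℚ
      F t = 14ℚ * (7ℚ * c * G t + Aa * t) + (ℤ.+ 28 ℚ./ 1) * c * (t * (t - N)) - (ℤ.+ 18 ℚ./ 1) * c * t
      -- A cell contributes 14 S k + 4 (S (k + 1) - S k) - 18c, whence 28 = 4 · 7 and 18 in `F`.
      F-step : ∀ k → F (nat (suc k)) ≡ F (nat k) + (6ℚ * S k + 8ℚ * B k - 2ℚ * c)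
      F-step k = solve 4 (λ t N c A →
        let Q = quadᵖ c N A
            G = Gᵖ N
            F = λ t → con 14ℚ :* (con 7ℚ :* c :* G t :+ A :* t) :+ con (ℤ.+ 28 ℚ./ 1) :* c :* (t :* (t :- N))
              :- con (ℤ.+ 18 ℚ./ 1) :* c :* t
        in F (con 1ℚ :+ t) := F t :+
          (con 6ℚ :* Q t :+ con 8ℚ :* (con ½ :* (Q t :+ Q (con 1ℚ :+ t)) :- con 2ℚ :* c) :- con 2ℚ :* c))
            refl (nat k) N c Aa
      F-total : F N - F 0ℚ + 0ℚ ≡ 0ℚ
      F-total = solve 2 (λ N c →
        let A = c :* (con 49ℚ :* (N :* N) :+ con 5ℚ) :* con ⅓ :* con ½ :* con (ℤ.+ 1 ℚ./ 7)
            G = Gᵖ N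
            F = λ t → con 14ℚ :* (con 7ℚ :* c :* G t :+ A :* t) :+ con (ℤ.+ 28 ℚ./ 1) :* c :* (t :* (t :- N))
              :- con (ℤ.+ 18 ℚ./ 1) :* c :* t
        in F N :- F (con 0ℚ) :+ con 0ℚ := con 0ℚ) refl N c

    -- Sources at `b` and at `w` share their symmetric part up to the constant `A`. Now `B` is
    -- sampled, shifted by one so that the source cell `m` falls on the end `N` of the turn, and `S`
    -- is solved from `sym-a`.
    module _ (A : ℚ) where
      private
        P S B F : ℕ → ℚ
        P k = quad A (nat k)
        S k = ½ * (P k + P (suc k)) - 3/2 * c
        B k = P (suc k)
        -- A cell contributes 14 P k + 11 (P (k + 1) - P k) - 11c, whence 77 = 11 · 7 and 11.
        F k = 14ℚ * (7ℚ * c * G (nat k) + A * nat k) + (ℤ.+ 77 ℚ./ 1) * c * (nat k * (nat k - N))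
          - (ℤ.+ 11 ℚ./ 1) * c * nat k

      symB-a : ∀ k → 2ℚ * S (suc k) - B (suc k) - B k ≡ - (3ℚ * c)
      symB-a k = solve 3 (λ x y c → con 2ℚ :* (con ½ :* (x :+ y) :- con 3/2 :* c) :- y :- x
        := :- (con 3ℚ :* c)) refl (P (suc k)) (P (suc (suc k))) c

      symB-b : ∀ k → 2ℚ * B k - S k - S (suc k) + 4ℚ * c ≡ 0ℚ
      symB-b k = solve 4 (λ t N c A → let Q = quadᵖ c N A in
        con 2ℚ :* Q (con 1ℚ :+ t) :- (con ½ :* (Q t :+ Q (con 1ℚ :+ t)) :- con 3/2 :* c)
          :- (con ½ :* (Q (con 1ℚ :+ t) :+ Q (con 1ℚ :+ (con 1ℚ :+ t))) :- con 3/2 :* c) :+ con 4ℚ :* c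
        := con 0ℚ) refl (nat k) N c A

      symB-a₀ : 2ℚ * S 0 - B 0 - B m ≡ 0ℚ * ½ - 3ℚ * c
      symB-a₀ = solve 3 (λ N c A → let Q = quadᵖ c N A in
        con 2ℚ :* (con ½ :* (Q (con 0ℚ) :+ Q (con 1ℚ :+ con 0ℚ)) :- con 3/2 :* c) :- Q (con 1ℚ :+ con 0ℚ) :- Q N
        := con 0ℚ :* con ½ :- con 3ℚ :* c) refl N c A

      symB-bz : 2ℚ * B m - S m - S 0 + 4ℚ * c ≡ ½
      symB-bz = trans (solve 3 (λ t c A → let N = con 1ℚ :+ t ; Q = quadᵖ c N A in
        con 2ℚ :* Q (con 1ℚ :+ t) :- (con ½ :* (Q t :+ Q (con 1ℚ :+ t)) :- con 3/2 :* c)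
          :- (con ½ :* (Q (con 0ℚ) :+ Q (con 1ℚ :+ con 0ℚ)) :- con 3/2 :* c) :+ con 4ℚ :* c
        := c :* (con 14ℚ :* N) :* con ½) refl (nat m) c A) (cong (_* ½) cN)

      totalB : sumᶠ {n} (λ k → 6ℚ * S (toℕ k) + 8ℚ * B (toℕ k) - 2ℚ * c) ≡ F n - F 0
      totalB = sumᶠ-telescope n F (λ k → 6ℚ * S k + 8ℚ * B k - 2ℚ * c) λ k → solve 4 (λ t N c A →
        let Q = quadᵖ c N A
            G = Gᵖ N
            F = λ t → con 14ℚ :* (con 7ℚ :* c :* G t :+ A :* t) :+ con (ℤ.+ 77 ℚ./ 1) :* c :* (t :* (t :- N))
              :- con (ℤ.+ 11 ℚ./ 1) :* c :* t
        in F (con 1ℚ :+ t) := F t :+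
          (con 6ℚ :* (con ½ :* (Q t :+ Q (con 1ℚ :+ t)) :- con 3/2 :* c) :+ con 8ℚ :* Q (con 1ℚ :+ t)
            :- con 2ℚ :* c)) refl (nat k) N c A

      -- Kept general in `A` because the two kinds of sources need different totals: 0 for `b` and
      -- -1 for `w`.
      excessB : F n - F 0 ≡ 14ℚ * N * (A - Ab)
      excessB = solve 3 (λ N c A →
        let Ab = c :* (con 49ℚ :* (N :* N) :- con (ℤ.+ 16 ℚ./ 1)) :* con ⅓ :* con ½ :* con (ℤ.+ 1 ℚ./ 7)
            G = Gᵖ N
            F = λ t → con 14ℚ :* (con 7ℚ :* c :* G t :+ A :* t) :+ con (ℤ.+ 77 ℚ./ 1) :* c :* (t :* (t :- N))
              :- con (ℤ.+ 11 ℚ./ 1) :* c :* t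
        in F N :- F (con 0ℚ) := con 14ℚ :* N :* (A :- Ab)) refl N c A

    profile-b : Profile n ε c 0ℚ 1ℚ 0ℚ m
    profile-b = record
      { S = λ k → ½ * (quad Ab (nat k) + quad Ab (nat (suc k))) - 3/2 * c
      ; B = λ k → quad Ab (nat (suc k)) ; α = α ; β = β
      ; sym-a   = symB-a Ab ; sym-b = symB-b Ab ; sym-a₀ = symB-a₀ Ab ; sym-bz = symB-bz Ab
      ; anti-a  = λ k → solve 3 (λ e x y → con 4ℚ :* (e :* (con ¼ :* (x :+ y))) :- e :* y
           := e :* x) refl ε (q κ (suc k)) (q κ (suc (suc k)))
      ; anti-b  = λ k → solve 6 (λ x y an bn e κ → let q = qᵖ an bn e κ ; x′ = A′ᵖ x y ; y′ = B′ᵖ x y in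
          con 3ℚ :* (e :* q x′ y′) :- e :* (con ¼ :* (q x y :+ q x′ y′))
            := e :* (con ¼ :* (q x′ y′ :+ q (A′ᵖ x′ y′) (B′ᵖ x′ y′))))
          refl (pellA k) (pellB k) an bn ε κ
      ; anti-a₀ = begin
          4ℚ * α 0 - β 0
            ≡⟨ solve 5 (λ an bn e κ y → let q = qᵖ an bn e κ in
                 con 4ℚ :* (e :* (con ¼ :* (q (con 1ℚ) (con 0ℚ) :+ y))) :- e :* y
                 := e :* (e :* q an bn) :+ con 0ℚ :* con ½ :- (e :* e :- con 1ℚ) :* (e :* κ :* bn))
                   refl an bn ε κ (q κ 1) ⟩
          ε * β m + 0ℚ * ½ - (ε * ε - 1ℚ) * (ε * κ * bn)
            ≡⟨ cong (λ x → ε * β m + 0ℚ * ½ - (x - 1ℚ) * (ε * κ * bn)) ε² ⟩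
          ε * β m + 0ℚ * ½ - (1ℚ - 1ℚ) * (ε * κ * bn)
            ≡⟨ solve 2 (λ X u → X :- (con 1ℚ :- con 1ℚ) :* u := X) refl (ε * β m + 0ℚ * ½) (ε * κ * bn) ⟩
          ε * β m + 0ℚ * ½ ∎
      ; anti-bz = begin
          3ℚ * β m - α m
            ≡⟨ solve 4 (λ x y e κ → let an = A′ᵖ x y ; bn = B′ᵖ x y ; q = qᵖ an bn e κ ; o = con 1ℚ ; z = con 0ℚ in
               con 3ℚ :* (e :* q an bn) :- e :* (con ¼ :* (q x y :+ q an bn))
               := e :* (e :* (con ¼ :*
                 (q o z :+ q (A′ᵖ o z) (B′ᵖ o z)))) :+ con ¼ :*
                   (κ :* (con 4ℚ :* (an :- e)))
                  :- con ¼ :* (con 2ℚ :* κ :* e :* ((x :* x :- con 6ℚ :* (y :* y)) :- con 1ℚ)) :+ con ¼ :*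
                    (κ :* (con 4ℚ :* an :- con 2ℚ :* e) :* (e :* e :- con 1ℚ)))
               refl (pellA m) (pellB m) ε κ ⟩
          ε * α 0 + ¼ * (κ * (4ℚ * (an - ε))) - ¼ *
            (2ℚ * κ * ε * ((pellA m * pellA m - 6ℚ * (pellB m * pellB m)) - 1ℚ)) + ¼ *
              (κ * (4ℚ * an - 2ℚ * ε) * (ε * ε - 1ℚ))
            ≡⟨ cong₂ (λ x y → ε * α 0 + ¼ * (κ * (4ℚ * (an - ε))) - ¼ * (2ℚ * κ * ε * (x - 1ℚ)) + ¼ *
                 (κ * (4ℚ * an - 2ℚ * ε) * (y - 1ℚ))) (pell m) ε² ⟩
          ε * α 0 + ¼ * (κ * (4ℚ * (an - ε))) - ¼ * (2ℚ * κ * ε * (1ℚ - 1ℚ)) + ¼ *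
            (κ * (4ℚ * an - 2ℚ * ε) * (1ℚ - 1ℚ))
            ≡⟨ solve 5 (λ X D Y u v → X :+ con ¼ :* (con 2ℚ :* D :* Y) :- con ¼ :* (u :* (con 1ℚ :- con 1ℚ))
                 :+ con ¼ :* (v :* (con 1ℚ :- con 1ℚ)) := X :+ con ½ :* (D :* Y))
                 refl (ε * α 0) D (4ℚ * (an - ε)) (2ℚ * κ * ε) (κ * (4ℚ * an - 2ℚ * ε)) ⟩
          ε * α 0 + ½ * (D * (4ℚ * (an - ε)))
            ≡⟨ cong (λ x → ε * α 0 + ½ * x) D-inv ⟩
          ε * α 0 + 1ℚ * ½ ∎
      ; balance = trans (cong (_+ 0ℚ) (trans (totalB Ab) (excessB Ab)))
          (solve 2 (λ N A → con 14ℚ :* N :* (A :- A) :+ con 0ℚ := con 0ℚ) refl N Ab)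
      }
      where
      κ : ℚ
      -- The same defect 4κ(an - ε) as for `profile-a`, divided here by the 4 of `anti-a`, must be
      -- ½.
      κ = 2ℚ * D
      α β : ℕ → ℚ
      -- The factor `ε` makes the value at the source, `β m = ε * q κ n`, equal to `q κ 0` in both
      -- chains.
      α k = ε * (¼ * (q κ k + q κ (suc k)))
      β k = ε * q κ (suc k)

    -- Reflection fixes every `w`, so this source excites no antisymmetric part.
    profile-w : Profile n ε c 0ℚ 0ℚ 1ℚ m
    profile-w = record
      { S = λ k → ½ * (quad A (nat k) + quad A (nat (suc k))) - 3/2 * c
      ; B = λ k → quad A (nat (suc k)) ; α = λ _ → 0ℚ ; β = λ _ → 0ℚ
      ; sym-a   = symB-a A ; sym-b = symB-b A ; sym-a₀ = symB-a₀ A ; sym-bz = symB-bz A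
      ; anti-a  = λ _ → refl
      ; anti-b  = λ _ → refl
      ; anti-a₀ = solve 1 (λ e → con 4ℚ :* con 0ℚ :- con 0ℚ := e :* con 0ℚ :+ con 0ℚ :* con ½) refl ε
      ; anti-bz = solve 1 (λ e → con 3ℚ :* con 0ℚ :- con 0ℚ := e :* con 0ℚ :+ con 0ℚ :* con ½) refl ε
      ; balance = begin
          sumᶠ {n} (λ k → 6ℚ * (½ * (quad A (nat (toℕ k)) + quad A (nat (suc (toℕ k)))) - 3/2 * c)
            + 8ℚ * quad A (nat (suc (toℕ k))) - 2ℚ * c) + 1ℚ
            ≡⟨ cong (_+ 1ℚ) (trans (totalB A) (excessB A)) ⟩
          14ℚ * N * (Ab - c - Ab) + 1ℚ
            ≡⟨ solve 3 (λ N c A → con 14ℚ :* N :* (A :- c :- A) :+ con 1ℚ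
                 := con 1ℚ :- c :* (con 14ℚ :* N)) refl N c Ab ⟩
          1ℚ - c * (14ℚ * N)
            ≡⟨ cong (_-_ 1ℚ) cN ⟩
          0ℚ ∎
      }
      where
      A : ℚ
      -- The source adds 1 to the weighted sum of the potential; lowering the constant by `c` at
      -- total degree 14N compensates for it.
      A = Ab - c

    Ka Kb Kw : ℚ
    Ka = Aa + 3/2 * D * bn
    Kb = Ab + 2ℚ * D * bn
    Kw = Ab - c - c + ½

    value-a : Profile.S profile-a 0 + Profile.α profile-a 0 ≡ Ka
    value-a = solve 7 (λ N c D an bn e A → (con 7ℚ :* c :* (con 0ℚ :* (con 0ℚ :- N)) :+ A) :+ con 3/2 :* D :*
      (bn :* con 1ℚ :- (an :- e) :* con 0ℚ)
      := A :+ con 3/2 :* D :* bn) refl N c D an bn ε Aa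

    value-b : Profile.B profile-b m + Profile.β profile-b m ≡ Kb
    value-b = trans (solve 7
      (λ N c D an bn e A → (con 7ℚ :* c :* (N :* (N :- N)) :+ A) :+ e :*
        (con 2ℚ :* D :* (bn :* an :- (an :- e) :* bn))
      := A :+ (e :* e) :* (con 2ℚ :* D :* bn)) refl N c D an bn ε Ab)
      (cong (Ab +_) (trans (cong (_* (2ℚ * D * bn)) ε²) (*-identityˡ (2ℚ * D * bn))))

    value-w : Profile.B profile-w m - c + ½ ≡ Kw
    value-w = solve 3 (λ N c A → (con 7ℚ :* c :* (N :* (N :- N)) :+ (A :- c)) :- c :+ con ½
      := A :- c :- c :+ con ½) refl N c Ab

    -- The constants combine as 21 = 6 · 3/2 + 6 · 2 and -19 = (6 · 5 - 8 · 16 - 4 · 42) / 14, and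
    -- the ½ in `Kw` yields the term linear in `N`.
    kf-value : 14ℚ * N * (N * (6ℚ * Ka + 6ℚ * Kb + 2ℚ * Kw))
             ≡ kfClosed n D
    kf-value = begin
      14ℚ * N * (N * (6ℚ * Ka + 6ℚ * Kb + 2ℚ * Kw))
        ≡⟨ solve 4 (λ N c D bn →
            let Aa = c :* (con 49ℚ :* (N :* N) :+ con 5ℚ) :* con ⅓ :* con ½ :* con (ℤ.+ 1 ℚ./ 7)
                Ab = c :* (con 49ℚ :* (N :* N) :- con (ℤ.+ 16 ℚ./ 1)) :* con ⅓ :* con ½ :* con (ℤ.+ 1 ℚ./ 7)
            in con 14ℚ :* N :* (N :*
              (con 6ℚ :* (Aa :+ con 3/2 :* D :* bn) :+ con 6ℚ :* (Ab :+ con 2ℚ :* D :* bn) :+ con 2ℚ :*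
                (Ab :- c :- c :+ con ½)))
            := con 14ℚ :* N :* (c :* (con 14ℚ :* N) :*
              ((con 49ℚ :* (N :* N) :- con 19ℚ) :* con (ℤ.+ 1 ℚ./ 42)) :+ N :+ con 21ℚ :* N :* bn :* D))
                refl N c D bn ⟩
      14ℚ * N * (c * (14ℚ * N) * ((49ℚ * (N * N) - 19ℚ) * (ℤ.+ 1 ℚ./ 42)) + N + 21ℚ * N * bn * D)
        ≡⟨ cong (λ x → 14ℚ * N * (x * ((49ℚ * (N * N) - 19ℚ) * (ℤ.+ 1 ℚ./ 42)) + N + 21ℚ * N * bn * D)) cN ⟩
      14ℚ * N * (1ℚ * ((49ℚ * (N * N) - 19ℚ) * (ℤ.+ 1 ℚ./ 42)) + N + 21ℚ * N * bn * D)
        ≡⟨ solve 3 (λ N D bn →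
             con 14ℚ :* N :* (con 1ℚ :* ((con 49ℚ :* (N :* N) :- con 19ℚ) :* con (ℤ.+ 1 ℚ./ 42)) :+ N :+
               con 21ℚ :* N :* bn :* D)
            := con 14ℚ :* N :* ((con 49ℚ :* (N :* N) :+ con 42ℚ :* N :- con 19ℚ) :* con (ℤ.+ 1 ℚ./ 42) :+
              con 21ℚ :* N :* bn :* D)) refl N D bn ⟩
      14ℚ * N * ((49ℚ * (N * N) + 42ℚ * N - 19ℚ) * (ℤ.+ 1 ℚ./ 42) + 21ℚ * N * bn * D) ∎

-- Naturals as rationals, bounds on Pell numbers, and inverses.

normalize≡nat : ∀ k → ℚ.normalize k 1 ≡ nat k
normalize≡nat zero    = refl
normalize≡nat (suc k) = begin
  ℚ.normalize (suc k) 1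
    ≡⟨ cong (λ i → i ℚ./ 1) (cong₂ ℤ._+_ (refl {x = ℤ.+ 1}) (sym (ℤₚ.*-identityʳ (ℤ.+ k)))) ⟩
  1ℚ + ℚ.mkℚ (ℤ.+ k) 0 (coprime-sym (1-coprimeTo k))
    ≡⟨ cong (1ℚ +_) (normalize-coprime (coprime-sym (1-coprimeTo k))) ⟨
  1ℚ + ℚ.normalize k 1
    ≡⟨ cong (1ℚ +_) (normalize≡nat k) ⟩
  1ℚ + nat k ∎

nat-+ : ∀ i j → nat (i ℕ.+ j) ≡ nat i + nat j
nat-+ zero    j = sym (+-identityˡ (nat j))
nat-+ (suc i) j = trans (cong (1ℚ +_) (nat-+ i j)) (sym (+-assoc 1ℚ (nat i) (nat j)))

nat-* : ∀ i j → nat (i ℕ.* j) ≡ nat i * nat j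
nat-* zero    j = sym (*-zeroˡ (nat j))
nat-* (suc i) j = trans (nat-+ j (i ℕ.* j)) (trans (cong (nat j +_) (nat-* i j))
  (solve 2 (λ x y → y :+ x :* y := (con 1ℚ :+ x) :* y) refl (nat i) (nat j)))

nat-nonNeg : ∀ k → 0ℚ ℚ.≤ nat k
nat-nonNeg zero    = ≤-refl
nat-nonNeg (suc k) = ≤-trans (from-yes (0ℚ ≤? 1ℚ)) (+-mono-≤ (≤-refl {1ℚ}) (nat-nonNeg k))

pell-bounds : ∀ k → (1ℚ ℚ.≤ pellA k) × (0ℚ ℚ.≤ pellB k)
-- Keeps `pellA n` away from `ε`, which is 1 or -1, so that `D` inverts a nonzero number.
pell-grows : ∀ k → 5ℚ ℚ.≤ pellA (suc k)

pell-bounds zero    = ≤-refl , ≤-refl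
pell-bounds (suc k) = ≤-trans (from-yes (1ℚ ≤? 5ℚ)) (pell-grows k) ,
  ≤-trans (from-yes (0ℚ ≤? 2ℚ)) (+-mono-≤ {2ℚ} {2ℚ * pellA k} {0ℚ} {5ℚ * pellB k}
    (*-monoˡ-≤-nonNeg 2ℚ (proj₁ (pell-bounds k))) (*-monoˡ-≤-nonNeg 5ℚ (proj₂ (pell-bounds k))))

pell-grows k = +-mono-≤ {5ℚ} {5ℚ * pellA k} {0ℚ} {12ℚ * pellB k}
  (*-monoˡ-≤-nonNeg 5ℚ (proj₁ (pell-bounds k))) (*-monoˡ-≤-nonNeg 12ℚ (proj₂ (pell-bounds k)))

invℚ-inverse : ∀ {x} → x ≢ 0ℚ → x * invℚ x ≡ 1ℚ
invℚ-inverse {x} x≢0 with x ≟ 0ℚ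
... | yes x≡0 = ⊥-elim (x≢0 x≡0)
... | no  x≢0 = *-inverseʳ x {{ℚ.≢-nonZero x≢0}}

invℚ-unique : ∀ {x y} → x * y ≡ 1ℚ → invℚ x ≡ y
invℚ-unique {x} {y} xy = begin
  invℚ x           ≡⟨ *-identityʳ (invℚ x) ⟨
  invℚ x * 1ℚ      ≡⟨ cong (invℚ x *_) xy ⟨
  invℚ x * (x * y) ≡⟨ solve 3 (λ i x y → i :* (x :* y) := x :* i :* y) refl (invℚ x) x y ⟩
  x * invℚ x * y   ≡⟨ cong (_* y) (invℚ-inverse x≢0) ⟩
  1ℚ * y           ≡⟨ *-identityˡ y ⟩
  y                ∎
  where
  x≢0 : x ≢ 0ℚ
  x≢0 x≡0 = from-no (0ℚ ≟ 1ℚ) (trans (sym (*-zeroˡ y)) (trans (cong (_* y) (sym x≡0)) xy))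

-- The closed formula inside the subfield generated by √6.

open Q2Ops

-- The element x + y √6.
surd : ℚ → ℚ → Q23
surd x y = q23 (q2 x 0ℚ) (q2 0ℚ y)

q23-≡ : ∀ {x y z t x′ y′ z′ t′} → x ≡ x′ → y ≡ y′ → z ≡ z′ → t ≡ t′ →
  q23 (q2 x y) (q2 z t) ≡ q23 (q2 x′ y′) (q2 z′ t′)
q23-≡ refl refl refl refl = refl

ιℕ≡surd : ∀ k → ιℕ k ≡ surd (nat k) 0ℚ
ιℕ≡surd k = cong ι (normalize≡nat k)

-- _⊗_ on polynomial expressions, which shows its coordinates to the ring solver.
Coords : ℕ → Set
Coords k = (Polynomial k × Polynomial k) × (Polynomial k × Polynomial k)

mulᶜ : ∀ {k} → Coords k → Coords k → Coords k
mulᶜ (x , y) (z , t) = add (mul x z) (mul (con 3ℚ , con 0ℚ) (mul y t)) , add (mul x t) (mul y z)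
  where
  add mul : ∀ {k} → Polynomial k × Polynomial k → Polynomial k × Polynomial k → Polynomial k × Polynomial k
  add (p , q) (r , s) = p :+ r , q :+ s
  mul (p , q) (r , s) = p :* r :+ con 2ℚ :* (q :* s) , p :* s :+ q :* r

surd-⊗ : ∀ x y z t → surd x y ⊗ surd z t ≡ surd (x * z + 6ℚ * (y * t)) (x * t + y * z)
surd-⊗ x y z t = q23-≡
  (solve 4 (λ x y z t → proj₁ (proj₁ (prod x y z t)) := x :* z :+ con 6ℚ :* (y :* t)) refl x y z t)
  (solve 4 (λ x y z t → proj₂ (proj₁ (prod x y z t)) := con 0ℚ) refl x y z t)
  (solve 4 (λ x y z t → proj₁ (proj₂ (prod x y z t)) := con 0ℚ) refl x y z t)
  (solve 4 (λ x y z t → proj₂ (proj₂ (prod x y z t)) := x :* t :+ y :* z) refl x y z t)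
  where
  prod : ∀ {k} → (x y z t : Polynomial k) → Coords k
  prod x y z t = mulᶜ ((x , con 0ℚ) , (con 0ℚ , y)) ((z , con 0ℚ) , (con 0ℚ , t))

inv₂-fromℚ : ∀ {x y} → x * y ≡ 1ℚ → inv₂ (fromℚ₂ x) ≡ fromℚ₂ y
inv₂-fromℚ {x} {y} xy = cong₂ q2 (trans (cong (x *_) norm)
    (trans (solve 2 (λ x y → x :* (y :* y) := x :* y :* y) refl x y) (trans (cong (_* y) xy) (*-identityˡ y))))
  (solve 1 (λ m → :- (con 0ℚ :* m) := con 0ℚ) refl (invℚ (x * x - ℚ.normalize 2 1 * (0ℚ * 0ℚ))))
  where
  norm : invℚ (x * x - ℚ.normalize 2 1 * (0ℚ * 0ℚ)) ≡ y * y
  norm = invℚ-unique {x * x - ℚ.normalize 2 1 * (0ℚ * 0ℚ)} {y * y}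
    (trans (solve 2 (λ x y → (x :* x :- con 2ℚ :* (con 0ℚ :* con 0ℚ)) :* (y :* y) := (x :* y) :* (x :* y)) refl x y)
    (cong₂ _*_ xy xy))

-- Every denominator of the formula is rational, since the √6 parts cancel in a sum of conjugate
-- powers; exhibiting a rational inverse therefore evaluates each division.
inv-ι : ∀ {x y} → x * y ≡ 1ℚ → inv (ι x) ≡ ι y
inv-ι {x} {y} xy = trans (cong (λ m → q23 (fromℚ₂ x *₂ m) (-₂ (fromℚ₂ 0ℚ *₂ m))) norm) (q23-≡
  (trans (solve 2 (λ x y → x :* (y :* y) :+ con 2ℚ :* (con 0ℚ :* con 0ℚ) := x :* y :* y) refl x y)
    (trans (cong (_* y) xy) (*-identityˡ y)))
  (solve 2 (λ x y → x :* con 0ℚ :+ con 0ℚ :* (y :* y) := con 0ℚ) refl x y)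
  (solve 1 (λ y → :- (con 0ℚ :* (y :* y) :+ con 2ℚ :* (con 0ℚ :* con 0ℚ)) := con 0ℚ) refl y)
  (solve 1 (λ y → :- (con 0ℚ :* con 0ℚ :+ con 0ℚ :* (y :* y)) := con 0ℚ) refl y))
  where
  norm : inv₂ (fromℚ₂ x *₂ fromℚ₂ x +₂ -₂ (fromℚ₂ (ℚ.normalize 3 1) *₂ (fromℚ₂ 0ℚ *₂ fromℚ₂ 0ℚ))) ≡ fromℚ₂ (y * y)
  norm = trans (cong inv₂ (cong₂ q2
      (solve 1 (λ x → (x :* x :+ con 2ℚ :* (con 0ℚ :* con 0ℚ)) :+ con 0ℚ := x :* x) refl x)
      (solve 1 (λ x → (x :* con 0ℚ :+ con 0ℚ :* x) :+ con 0ℚ := con 0ℚ) refl x)))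
    (inv₂-fromℚ {x * x} {y * y}
      (trans (solve 2 (λ x y → (x :* x) :* (y :* y) := (x :* y) :* (x :* y)) refl x y) (cong₂ _*_ xy xy)))

^^-double : ∀ x k → x ^^ (2 ℕ.* suc k) ≡ x ⊗ (x ⊗ x ^^ (2 ℕ.* k))
^^-double x k = cong (x ^^_) (ℕₚ.*-suc 2 k)

√3+s√2 : ℚ → Q23
√3+s√2 s = q23 (q2 0ℚ s) (q2 1ℚ 0ℚ)

-- For `s` = ±1 the square of √3 + s√2 is 5 + 2s√6, so two multiplications make one Pell step;
-- keeping `s` symbolic treats both conjugates at once.
√3+s√2-square : ∀ {s} → s * s ≡ 1ℚ → ∀ x y →
  √3+s√2 s ⊗ (√3+s√2 s ⊗ surd x (s * y)) ≡ surd (5ℚ * x + 12ℚ * y) (s * (2ℚ * x + 5ℚ * y))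
√3+s√2-square {s} ss x y = q23-≡
  (trans (solve 3 (λ s x y → proj₁ (proj₁ (prod s x y))
    := con 3ℚ :* x :+ con 6ℚ :* (s :* s :* y) :+ s :* s :* (con 2ℚ :* x :+ con 6ℚ :* y)) refl s x y)
    (trans (cong (λ ss → 3ℚ * x + 6ℚ * (ss * y) + ss * (2ℚ * x + 6ℚ * y)) ss)
      (solve 2 (λ x y → con 3ℚ :* x :+ con 6ℚ :* (con 1ℚ :* y) :+ con 1ℚ :* (con 2ℚ :* x :+ con 6ℚ :* y)
        := con 5ℚ :* x :+ con 12ℚ :* y) refl x y)))
  (solve 3 (λ s x y → proj₂ (proj₁ (prod s x y)) := con 0ℚ) refl s x y)
  (solve 3 (λ s x y → proj₁ (proj₂ (prod s x y)) := con 0ℚ) refl s x y)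
  (trans (solve 3 (λ s x y → proj₂ (proj₂ (prod s x y))
    := s :* (con 2ℚ :* x :+ con 3ℚ :* y :+ con 2ℚ :* (s :* s :* y))) refl s x y)
    (trans (cong (λ ss → s * (2ℚ * x + 3ℚ * y + 2ℚ * (ss * y))) ss)
      (solve 3 (λ s x y → s :* (con 2ℚ :* x :+ con 3ℚ :* y :+ con 2ℚ :* (con 1ℚ :* y))
        := s :* (con 2ℚ :* x :+ con 5ℚ :* y)) refl s x y)))
  where
  prod : ∀ {k} → (s x y : Polynomial k) → Coords k
  prod s x y = mulᶜ θ (mulᶜ θ ((x , con 0ℚ) , (con 0ℚ , s :* y)))
    where θ = (con 0ℚ , s) , (con 1ℚ , con 0ℚ)

√3+s√2-pow : ∀ {s} → s * s ≡ 1ℚ → ∀ k → √3+s√2 s ^^ (2 ℕ.* k) ≡ surd (pellA k) (s * pellB k)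
√3+s√2-pow {s} ss zero    = cong (surd 1ℚ) (sym (*-zeroʳ s))
√3+s√2-pow {s} ss (suc k) = trans (^^-double (√3+s√2 s) k)
  (trans (cong (λ z → √3+s√2 s ⊗ (√3+s√2 s ⊗ z)) (√3+s√2-pow {s} ss k)) (√3+s√2-square {s} ss (pellA k) (pellB k)))

-- The conjugate powers differ by 2 `pellB n` √6, and the denominator is 2 (`pellA n` - ε) with
-- inverse 2D. The two factors √6 multiply to 6, and 7/8 · 6 · 2 · 2 = 21.
kfFormula-value : ∀ n ε D → D * (4ℚ * (pellA n - ε)) ≡ 1ℚ →
  kfFormula n (ι (- (2ℚ * ε))) ≡ ι (kfClosed n D)
kfFormula-value n ε D D-inv = begin
  kfFormula n (ι (- (2ℚ * ε)))
    ≡⟨ cong₂ _⊗_ prefactor (cong₂ _⊕_ polynomial (cong₂ _⊗_ (cong₂ _⊗_ coefficient difference) denominator)) ⟩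
  surd (14ℚ * N) 0ℚ ⊗ (surd p 0ℚ ⊕ ((surd 0ℚ q ⊗ surd 0ℚ (2ℚ * y)) ⊗ surd (2ℚ * D) 0ℚ))
    ≡⟨ cong (λ z → surd (14ℚ * N) 0ℚ ⊗ (surd p 0ℚ ⊕ z))
         (trans (cong (_⊗ surd (2ℚ * D) 0ℚ) (surd-⊗ 0ℚ q 0ℚ (2ℚ * y)))
           (surd-⊗ (0ℚ * 0ℚ + 6ℚ * (q * (2ℚ * y))) (0ℚ * (2ℚ * y) + q * 0ℚ) (2ℚ * D) 0ℚ)) ⟩
  surd (14ℚ * N) 0ℚ ⊗ surd (p + r) (0ℚ + r′)
    ≡⟨ surd-⊗ (14ℚ * N) 0ℚ (p + r) (0ℚ + r′) ⟩
  surd (14ℚ * N * (p + r) + 6ℚ * (0ℚ * (0ℚ + r′))) (14ℚ * N * (0ℚ + r′) + 0ℚ * (p + r))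
    ≡⟨ cong₂ surd
         (solve 4 (λ N p y D → let q = con 7ℚ :* N :* con ⅛
                                   r = (con 0ℚ :* con 0ℚ :+ con 6ℚ :* (q :* (con 2ℚ :* y))) :* (con 2ℚ :* D)
                                     :+ con 6ℚ :* ((con 0ℚ :* (con 2ℚ :* y) :+ q :* con 0ℚ) :* con 0ℚ)
                                   r′ = (con 0ℚ :* con 0ℚ :+ con 6ℚ :* (q :* (con 2ℚ :* y))) :* con 0ℚ :+
                                     (con 0ℚ :* (con 2ℚ :* y) :+ q :* con 0ℚ) :* (con 2ℚ :* D)
             in con 14ℚ :* N :* (p :+ r) :+ con 6ℚ :* (con 0ℚ :* (con 0ℚ :+ r′))
               := con 14ℚ :* N :* (p :+ con 21ℚ :* N :* y :* D)) refl N p y D)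
         (solve 4 (λ N p y D → let q = con 7ℚ :* N :* con ⅛
                                   r = (con 0ℚ :* con 0ℚ :+ con 6ℚ :* (q :* (con 2ℚ :* y))) :* (con 2ℚ :* D)
                                     :+ con 6ℚ :* ((con 0ℚ :* (con 2ℚ :* y) :+ q :* con 0ℚ) :* con 0ℚ)
                                   r′ = (con 0ℚ :* con 0ℚ :+ con 6ℚ :* (q :* (con 2ℚ :* y))) :* con 0ℚ :+
                                     (con 0ℚ :* (con 2ℚ :* y) :+ q :* con 0ℚ) :* (con 2ℚ :* D)
             in con 14ℚ :* N :* (con 0ℚ :+ r′) :+ con 0ℚ :* (p :+ r) := con 0ℚ) refl N p y D) ⟩
  ι (14ℚ * N * (p + 21ℚ * N * y * D)) ∎
  where
  ⅛ N x y p q r r′ : ℚ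
  ⅛ = ℤ.+ 1 ℚ./ 8
  N = nat n
  x = pellA n
  y = pellB n
  p = (49ℚ * (N * N) + 42ℚ * N - 19ℚ) * (ℤ.+ 1 ℚ./ 42)
  q = 7ℚ * N * ⅛
  r = (0ℚ * 0ℚ + 6ℚ * (q * (2ℚ * y))) * (2ℚ * D) + 6ℚ * ((0ℚ * (2ℚ * y) + q * 0ℚ) * 0ℚ)
  r′ = (0ℚ * 0ℚ + 6ℚ * (q * (2ℚ * y))) * 0ℚ + (0ℚ * (2ℚ * y) + q * 0ℚ) * (2ℚ * D)
  surd-⊗ι : ∀ x y z {u v} → x * z ≡ u → y * z ≡ v → surd x y ⊗ ι z ≡ surd u v
  surd-⊗ι x y z refl refl = trans (surd-⊗ x y z 0ℚ) (cong₂ surd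
    (solve 3 (λ x y z → x :* z :+ con 6ℚ :* (y :* con 0ℚ) := x :* z) refl x y z)
    (solve 3 (λ x y z → x :* con 0ℚ :+ y :* z := y :* z) refl x y z))
  prefactor : ιℕ (14 ℕ.* n) ≡ surd (14ℚ * N) 0ℚ
  prefactor = trans (ιℕ≡surd (14 ℕ.* n)) (cong ι (nat-* 14 n))
  polynomial : (ιℕ (49 ℕ.* n ℕ.* n ℕ.+ 42 ℕ.* n) ⊖ ιℕ 19) ⊘ ιℕ 42 ≡ surd p 0ℚ
  polynomial = trans (cong₂ _⊗_
    (cong (_⊖ ιℕ 19) (trans (ιℕ≡surd (49 ℕ.* n ℕ.* n ℕ.+ 42 ℕ.* n)) (cong ι expand)))
      (inv-ι {42ℚ} {ℤ.+ 1 ℚ./ 42} refl))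
    (surd-⊗ι (49ℚ * (N * N) + 42ℚ * N - 19ℚ) 0ℚ (ℤ.+ 1 ℚ./ 42) refl refl)
    where
    expand : nat (49 ℕ.* n ℕ.* n ℕ.+ 42 ℕ.* n) ≡ 49ℚ * (N * N) + 42ℚ * N
    expand = trans (nat-+ (49 ℕ.* n ℕ.* n) (42 ℕ.* n)) (cong₂ _+_
      (trans (nat-* (49 ℕ.* n) n) (trans (cong (_* N) (nat-* 49 n)) (*-assoc 49ℚ N N))) (nat-* 42 n))
  coefficient : (ιℕ 7 ⊗ √6 ⊗ ιℕ n) ⊘ ιℕ 8 ≡ surd 0ℚ q
  coefficient = trans (cong₂ _⊗_ (trans (cong (surd 0ℚ 7ℚ ⊗_) (ιℕ≡surd n)) (surd-⊗ι 0ℚ 7ℚ N (*-zeroˡ N) refl))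
    (inv-ι {8ℚ} {⅛} refl))
    (surd-⊗ι 0ℚ (7ℚ * N) ⅛ refl refl)
  plus : (√3 ⊕ √2) ^^ (2 ℕ.* n) ≡ surd x (1ℚ * y)
  plus = √3+s√2-pow {1ℚ} refl n
  minus : (√3 ⊖ √2) ^^ (2 ℕ.* n) ≡ surd x ((- 1ℚ) * y)
  minus = √3+s√2-pow { - 1ℚ} refl n
  difference : (√3 ⊕ √2) ^^ (2 ℕ.* n) ⊖ (√3 ⊖ √2) ^^ (2 ℕ.* n) ≡ surd 0ℚ (2ℚ * y)
  difference = trans (cong₂ _⊖_ plus minus) (cong₂ surd (solve 1 (λ x → x :- x := con 0ℚ) refl x)
    (solve 1 (λ y → con 1ℚ :* y :- con (- 1ℚ) :* y := con 2ℚ :* y) refl y))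
  denominator : inv ((√3 ⊕ √2) ^^ (2 ℕ.* n) ⊕ (√3 ⊖ √2) ^^ (2 ℕ.* n) ⊕ ι (- (2ℚ * ε))) ≡ surd (2ℚ * D) 0ℚ
  denominator = trans (cong inv (trans (cong₂ (λ z t → z ⊕ t ⊕ ι (- (2ℚ * ε))) plus minus)
      (cong (surd (x + x - 2ℚ * ε)) (solve 1 (λ y → con 1ℚ :* y :+ con (- 1ℚ) :* y :+ con 0ℚ := con 0ℚ) refl y))))
    (inv-ι {x + x - 2ℚ * ε} {2ℚ * D}
      (trans (solve 3 (λ x e D → (x :+ x :- con 2ℚ :* e) :* (con 2ℚ :* D)
        := D :* (con 4ℚ :* (x :- e))) refl x ε D) D-inv))

-- Evaluation for the two chains.

sumᶠ-const : ∀ n x → sumᶠ {n} (λ _ → x) ≡ nat n * x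
sumᶠ-const zero    x = sym (*-zeroˡ x)
sumᶠ-const (suc n) x = trans (cong (x +_) (sumᶠ-const n x)) (solve 2 (λ n x → x :+ n :* x
  := (con 1ℚ :+ n) :* x) refl (nat n) x)

byKind : ∀ {n} → ℚ → ℚ → ℚ → V n → ℚ
byKind x y z (a _) = x
byKind x y z (b _) = y
byKind x y z (w _) = z

sumV-byKind : ∀ n x y z → sumV {n} (λ v → degV v * byKind x y z v) ≡ nat n * (6ℚ * x + 6ℚ * y + 2ℚ * z)
sumV-byKind n x y z = trans (cong₂ _+_ (sumᶠ-const n _) (cong₂ _+_ (sumᶠ-const n _) (sumᶠ-const n _)))
  (solve 4 (λ n x y z → n :* (con 3ℚ :* x :+ con 3ℚ :* y) :+ (n :* (con 3ℚ :* x :+ con 3ℚ :* y) :+ n :* (con 2ℚ :* z))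
    := n :* (con 6ℚ :* x :+ con 6ℚ :* y :+ con 2ℚ :* z)) refl (nat n) x y z)

sumV-degV : ∀ n → sumV {n} degV ≡ 14ℚ * nat n
sumV-degV n = trans (cong₂ _+_ (sumᶠ-const n _) (cong₂ _+_ (sumᶠ-const n _) (sumᶠ-const n _)))
  (solve 1 (λ n → n :* con 6ℚ :+ (n :* con 6ℚ :+ n :* con 2ℚ) := con 14ℚ :* n) refl (nat n))

module Evaluation (μ : Bool) (l : ℕ) where
  open Chain μ l using (m; n; last)
  open ChainGreen μ l
  open ChainPotential μ l using (ε; GreenV-a; GreenV-b; GreenV-w)

  N an c D : ℚ
  N = nat n
  an = pellA n
  c = invℚ (14ℚ * N)
  D = invℚ (4ℚ * (an - ε))

  ε² : ε * ε ≡ 1ℚ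
  ε² = square μ
    where
    square : ∀ s → sg s * sg s ≡ 1ℚ
    square false = refl
    square true  = refl

  cN : c * (14ℚ * N) ≡ 1ℚ
  cN = trans (*-comm c (14ℚ * N)) (invℚ-inverse 14N≢0)
    where
    14≤14N : 14ℚ ℚ.≤ 14ℚ * N
    14≤14N = *-monoˡ-≤-nonNeg 14ℚ (+-mono-≤ {1ℚ} {1ℚ} {0ℚ} {nat m} ≤-refl (nat-nonNeg m))
    14N≢0 : 14ℚ * N ≢ 0ℚ
    14N≢0 eq = from-no (14ℚ ≤? 0ℚ) (subst (14ℚ ℚ.≤_) eq 14≤14N)

  D-inv : D * (4ℚ * (an - ε)) ≡ 1ℚ
  D-inv = trans (*-comm D (4ℚ * (an - ε))) (invℚ-inverse nonzero)
    where
    5≰sg : ∀ s → ¬ 5ℚ ℚ.≤ sg s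
    5≰sg false = from-no (5ℚ ≤? 1ℚ)
    5≰sg true  = from-no (5ℚ ≤? - 1ℚ)
    nonzero : 4ℚ * (an - ε) ≢ 0ℚ
    nonzero eq = 5≰sg μ (subst (5ℚ ℚ.≤_) an≡ε (pell-grows m))
      where
      an≡ε : an ≡ ε
      an≡ε = trans (solve 2 (λ x e → x := con ¼ :* (con 4ℚ :* (x :- e)) :+ e) refl an ε)
        (trans (cong (λ z → ¼ * z + ε) eq) (solve 1 (λ e → con ¼ :* con 0ℚ :+ e := e) refl ε))

  open Sequences m ε c D hiding (n; N; an)

  ka kb kw : ℚ
  ka = Ka ε² cN D-inv
  kb = Kb ε² cN D-inv
  kw = Kw ε² cN D-inv

  base-a : GreenV c (a (false , Fin.zero)) ka
  base-a = let P , eq = at (sym (toℕ-fromℕ m)) in subst (GreenV c (a (false , Fin.zero))) eq (GreenV-a P)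
    where
    -- The index `toℕ (fromℕ m)` does not compute to `m`; generalising it to `z` lets one match
    -- transfer the profile together with its value.
    at : ∀ {z} → m ≡ z → Σ (Profile n ε c 1ℚ 0ℚ 0ℚ z) λ P → Profile.S P 0 + Profile.α P 0 ≡ ka
    at refl = profile-a ε² cN D-inv , value-a ε² cN D-inv

  base-b : GreenV c (b (false , last)) kb
  base-b = let P , eq = at (sym (toℕ-fromℕ m)) in subst (GreenV c (b (false , last))) eq (GreenV-b P)
    where
    at : ∀ {z} → m ≡ z → Σ (Profile n ε c 0ℚ 1ℚ 0ℚ z) λ P → Profile.B P z + Profile.β P z ≡ kb
    at refl = profile-b ε² cN D-inv , value-b ε² cN D-inv

  base-w : GreenV c (w last) kw
  base-w = let P , eq = at (sym (toℕ-fromℕ m)) in subst (GreenV c (w last)) eq (GreenV-w P)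
    where
    at : ∀ {z} → m ≡ z → Σ (Profile n ε c 0ℚ 0ℚ 1ℚ z) λ P → Profile.B P z - c + ½ ≡ kw
    at refl = profile-w ε² cN D-inv , value-w ε² cN D-inv

  greens : ∀ v → GreenV c v (byKind ka kb kw v)
  greens (a p) = green-a base-a p
  greens (b p) = green-b base-b p
  greens (w k) = green-w base-w k

  isDegreeKirchhoffIndex : IsDegreeKirchhoffIndex (edges μ n) (5 ℕ.* n) (kfClosed n D)
  isDegreeKirchhoffIndex = subst (IsDegreeKirchhoffIndex (edges μ n) (5 ℕ.* n)) K≡
    (degreeKirchhoffIndex-V {c} {byKind ka kb kw} greens)
    where
    K≡ : sumV {n} degV * sumV {n} (λ v → degV v * byKind ka kb kw v) ≡ kfClosed n D
    K≡ = trans (cong₂ _*_ (sumV-degV n) (sumV-byKind n ka kb kw)) (kf-value ε² cN D-inv)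

-- The summand `x` is abstract so that a closed computation can identify -2ε with the stated
-- constants -2 and 2.
withFormula : ∀ n ε D {E x} → D * (4ℚ * (pellA n - ε)) ≡ 1ℚ → ι (- (2ℚ * ε)) ≡ x →
  IsDegreeKirchhoffIndex E (5 ℕ.* n) (kfClosed n D) →
  Σ ℚ λ K → IsDegreeKirchhoffIndex E (5 ℕ.* n) K × ι K ≡ kfFormula n x
withFormula n ε D D-inv refl isKf = kfClosed n D , isKf , sym (kfFormula-value n ε D D-inv)

kfClosed-isIndex : ∀ μ n → 2 ℕ.≤ n → Σ ℚ λ D →
  (D * (4ℚ * (pellA n - sg μ)) ≡ 1ℚ) × IsDegreeKirchhoffIndex (edges μ n) (5 ℕ.* n) (kfClosed n D)
kfClosed-isIndex μ (suc (suc l)) (s≤s (s≤s z≤n)) =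
  Evaluation.D μ l , Evaluation.D-inv μ l , Evaluation.isDegreeKirchhoffIndex μ l

theorem6 : (n : ℕ) → 2 ℕ.≤ n →
    (Σ ℚ λ K → IsDegreeKirchhoffIndex (cylinderEdges n) (5 ℕ.* n) K × ι K ≡ kfFormula n (⊝ ιℕ 2))
    × (Σ ℚ λ K → IsDegreeKirchhoffIndex (mobiusEdges n) (5 ℕ.* n) K × ι K ≡ kfFormula n (ιℕ 2))
theorem6 n 2≤n =
  (let D , D-inv , isKf = kfClosed-isIndex false n 2≤n in
   withFormula n (sg false) D {cylinderEdges n} {⊝ ιℕ 2} D-inv refl isKf) ,
  (let D , D-inv , isKf = kfClosed-isIndex true n 2≤n in
   withFormula n (sg true) D {mobiusEdges n} {ιℕ 2} D-inv refl isKf)
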